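{- Let $G$ be a finite $2$-edge-connected graph (multiple edges allowed, no loops) that is not a regular bipartite graph. Let $w \in V(G)$ and $\lambda \in \{0,1\}$. Then $G$ has a spanning weakly even $(w,\lambda)$-tree.
   Context: Graphs are finite, may have multiple edges, but no loops. $\Delta(G)$ denotes the maximum degree of $G$. Given an ordered bipartition $(X,Y)$ of a bipartite graph $H$, a vertex of $H$ is type-$0$ if it lies in $X$ and type-$1$ if it lies in $Y$. For $w \in V(H)$ and $\lambda \in \{0,1\}$, the $(w,\lambda)$-bipartition of a connected bipartite graph $H$ is the ordered bipartition of $H$ in which $w$ has type $\lambda$; a $(w,\lambda)$-tree is a tree equipped with its $(w,\lambda)$-bipartition. A tree $T \subseteq G$ with ordered bipartition $(X,Y)$ is weakly even (in $G$) if every leaf of $T$ that has degree $\Delta(G)$ in $G$ is type-$0$ (i.e. lies in $X$). -}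

module Defs where

open import Data.Nat using (ℕ; zero; suc; _⊔_)
open import Data.Bool using (Bool; true; false; not; _∨_; _∧_) renaming (_≟_ to _≟B_)
open import Data.Fin using (Fin)
open import Data.Fin.Properties using () renaming (_≟_ to _≟F_)
open import Data.List using (List; []; _∷_; foldr; map; length; filter)
open import Data.List.Relation.Unary.Unique.Propositional using (Unique)
open import Data.Product using (_×_; _,_; proj₁; proj₂; Σ; ∃; ∃-syntax)
open import Data.Sum using (_⊎_)
open import Relation.Binary.PropositionalEquality using (_≡_; _≢_)
open import Relation.Nullary.Decidable using (⌊_⌋)
open import Data.List.Base using (allFin)

record Graph : Set where
  field
    n : ℕ
    m : ℕ
    ends : Fin m → Fin n × Fin n
    loopless : ∀ e → proj₁ (ends e) ≢ proj₂ (ends e)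

open Graph public

Vertex : Graph → Set
Vertex G = Fin (n G)

Edge : Graph → Set
Edge G = Fin (m G)

EdgeSet : Graph → Set
EdgeSet G = Edge G → Bool

Joins : (G : Graph) → Edge G → Vertex G → Vertex G → Set
Joins G e u v = (ends G e ≡ (u , v)) ⊎ (ends G e ≡ (v , u))

data Walk (G : Graph) (S : EdgeSet G) : Vertex G → Vertex G → List (Edge G) → Set where
  nil  : ∀ {u} → Walk G S u u []
  cons : ∀ {u v w es} (e : Edge G) → S e ≡ true → Joins G e u v →
         Walk G S v w es → Walk G S u w (e ∷ es)

Connected : (G : Graph) → EdgeSet G → Set
Connected G S = ∀ (u v : Vertex G) → ∃[ es ] Walk G S u v es

Acyclic : (G : Graph) → EdgeSet G → Set
Acyclic G S = ∀ (u : Vertex G) (es : List (Edge G)) →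
  Walk G S u u es → Unique es → es ≡ []

SpanningTree : (G : Graph) → EdgeSet G → Set
SpanningTree G S = Connected G S × Acyclic G S

allEdges : (G : Graph) → EdgeSet G
allEdges G _ = true

IsConnected : Graph → Set
IsConnected G = Connected G (allEdges G)

TwoEdgeConnected : Graph → Set
TwoEdgeConnected G =
  IsConnected G × (∀ (f : Edge G) → Connected G (λ e → not ⌊ e ≟F f ⌋))

incident : (G : Graph) → Vertex G → Edge G → Bool
incident G v e = ⌊ proj₁ (ends G e) ≟F v ⌋ ∨ ⌊ proj₂ (ends G e) ≟F v ⌋

degIn : (G : Graph) → EdgeSet G → Vertex G → ℕ
degIn G S v = length (filter (λ e → (S e ∧ incident G v e) ≟B true) (allFin (m G)))

deg : (G : Graph) → Vertex G → ℕ
deg G = degIn G (allEdges G)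

Δ : Graph → ℕ
Δ G = foldr _⊔_ 0 (map (deg G) (allFin (n G)))

Regular : Graph → Set
Regular G = ∃[ d ] (∀ (v : Vertex G) → deg G v ≡ d)

-- col is a proper 2-colouring of the edges in S (an ordered bipartition:
-- type-0 = false, type-1 = true)
ProperOn : (G : Graph) → EdgeSet G → (Vertex G → Bool) → Set
ProperOn G S col = ∀ (e : Edge G) → S e ≡ true →
  col (proj₁ (ends G e)) ≢ col (proj₂ (ends G e))

Bipartite : Graph → Set
Bipartite G = ∃[ col ] ProperOn G (allEdges G) col

RegularBipartite : Graph → Set
RegularBipartite G = Regular G × Bipartite G

WeaklyEven : (G : Graph) → EdgeSet G → (Vertex G → Bool) → Set
WeaklyEven G S col = ∀ (v : Vertex G) → degIn G S v ≡ 1 → deg G v ≡ Δ G → col v ≡ false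

-- type bits: λ ∈ {0,1} encoded as Bool (false = 0, true = 1)

module Submission where

-- Let Y be the set of type-1 vertices and K ⊆ Y those of degree Δ. If the bichromatic edges form a connected graph H
-- in which |N(S)| > |S| for every nonempty S ⊆ K, then (Lovász) H has a forest in which every vertex of K has degree 2,
-- and any spanning tree of H containing it is weakly even. To reach such a colouring, consider one with H connected
-- and a minimal S ⊆ K with |N(S)| ≤ |S|. By minimality no y ∈ S is a cut vertex of H, so if some y ≠ w in S has a
-- neighbour in Y, then y can be moved to X and H stays connected. Otherwise only w can send edges from S to Y, and
-- double counting edges shows that w ∈ S, since otherwise G would be regular bipartite. In that case S ∪ N(S) is
-- added to a growing connected core, whose colours are kept; counting again, w has a neighbour outside the core, and
-- the rest is recoloured so that this neighbour has type 0.

open import Defs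
open import Data.Bool using (Bool; true; false; not; _∨_; _∧_; if_then_else_) renaming (_≟_ to _≟ᵇ_)
open import Data.Bool.Properties using (not-¬)
open import Data.Empty using (⊥; ⊥-elim)
open import Data.Fin using (Fin; zero; suc; _≟_)
open import Data.Fin.Properties using (any?; all?)
open import Data.Fin.Subset.Properties using (anySubset?)
open import Data.List using (List; []; _∷_; _++_; length; filter; map; foldr)
import Data.List as List
open import Data.List.Membership.Propositional using () renaming (_∈_ to _∈ˡ_)
open import Data.List.Membership.Propositional.Properties using (∈-allFin)
open import Data.List.Relation.Unary.All as All using (All; []; _∷_)
open import Data.List.Relation.Unary.All.Properties using (++⁺)
open import Data.List.Relation.Unary.AllPairs using ([]; _∷_)
open import Data.List.Relation.Unary.Any using (here; there)
open import Data.List.Relation.Unary.Unique.Propositional using (Unique)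
open import Data.Nat using (ℕ; zero; suc; _+_; _*_; _∸_; _⊔_; _≤_; _<_; z≤n; s≤s; s≤s⁻¹; _≤?_)
import Data.Nat as ℕ
open import Data.Nat.Properties hiding (_≟_)
open import Data.Product using (_×_; _,_; proj₁; proj₂; ∃; ∃-syntax)
open import Data.Product.Properties using (≡-dec)
open import Data.Sum using (_⊎_; inj₁; inj₂; swap)
open import Data.Vec using (lookup; tabulate)
open import Data.Vec.Properties using (lookup∘tabulate)
open import Function using (_∘_; id)
open import Relation.Binary.PropositionalEquality
open import Relation.Nullary using (¬_; Dec; yes; no; ¬?)
open import Relation.Nullary.Decidable using (⌊_⌋; map′; _×-dec_; _⊎-dec_; _→-dec_; decidable-stable)
open import Algebra.Properties.CommutativeMonoid.Sum +-0-commutativeMonoid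
  using (sum; sum-cong-≗; ∑-distrib-+; ∑-comm)
open import Algebra.Properties.Semiring.Sum +-*-semiring using (*-distribˡ-sum; *-distribʳ-sum)

-- Finite sets as Boolean functions: sizes, sums and search.

module FiniteSets where

  private variable
    k : ℕ

  absurd : ∀ {ℓ} {A : Set ℓ} {b : Bool} → b ≡ true → b ≡ false → A
  absurd refl ()

  true? : ∀ b → (b ≡ true) ⊎ (b ≡ false)
  true? true  = inj₁ refl
  true? false = inj₂ refl

  BSet : ℕ → Set
  BSet k = Fin k → Bool

  _⊆_ : BSet k → BSet k → Set
  S ⊆ Q = ∀ v → S v ≡ true → Q v ≡ true

  infixl 6 _∪_ _∩_ _∖_

  opaque
    _∪_ _∩_ _∖_ : BSet k → BSet k → BSet k
    (S ∪ Q) v = S v ∨ Q v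
    (S ∩ Q) v = S v ∧ Q v
    (S ∖ Q) v = S v ∧ not (Q v)

    ⁅_⁆ : Fin k → BSet k
    ⁅ y ⁆ v = ⌊ v ≟ y ⌋

    _[_↦_] : BSet k → Fin k → Bool → BSet k
    (S [ y ↦ b ]) v = if ⌊ v ≟ y ⌋ then b else S v

  private variable
    S Q U : BSet k
    v y : Fin k
    b : Bool

  opaque
    unfolding _∪_

    ∪⁻ : (S ∪ Q) v ≡ true → S v ≡ true ⊎ Q v ≡ true
    ∪⁻ {S = S} {v = v} h with S v
    ... | true  = inj₁ refl
    ... | false = inj₂ h

    ∪⁺ˡ : S v ≡ true → (S ∪ Q) v ≡ true
    ∪⁺ˡ h rewrite h = refl

    ∪⁺ʳ : Q v ≡ true → (S ∪ Q) v ≡ true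
    ∪⁺ʳ {v = v} {S = S} h with S v
    ... | true  = refl
    ... | false = h

    ∩⁻ : (S ∩ Q) v ≡ true → S v ≡ true × Q v ≡ true
    ∩⁻ {S = S} {v = v} h with S v
    ... | true  = refl , h

    ∩⁺ : S v ≡ true → Q v ≡ true → (S ∩ Q) v ≡ true
    ∩⁺ h g rewrite h = g

    ∖⁻ : (S ∖ Q) v ≡ true → S v ≡ true × Q v ≡ false
    ∖⁻ {S = S} {Q = Q} {v = v} h with S v | Q v
    ... | true | false = refl , refl

    ∖⁺ : S v ≡ true → Q v ≡ false → (S ∖ Q) v ≡ true
    ∖⁺ h g rewrite h | g = refl

    ⁅⁆-self : ⁅ y ⁆ y ≡ true
    ⁅⁆-self {y = y} with y ≟ y
    ... | yes _ = refl
    ... | no ¬p = ⊥-elim (¬p refl)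

    ⁅⁆⁻ : ⁅ y ⁆ v ≡ true → v ≡ y
    ⁅⁆⁻ {y = y} {v = v} h with v ≟ y
    ... | yes p = p

    ⁅⁆-≢ : v ≢ y → ⁅ y ⁆ v ≡ false
    ⁅⁆-≢ {v = v} {y = y} h with v ≟ y
    ... | yes p = ⊥-elim (h p)
    ... | no _  = refl

    update-same : (S [ y ↦ b ]) y ≡ b
    update-same {y = y} with y ≟ y
    ... | yes _ = refl
    ... | no ¬p = ⊥-elim (¬p refl)

    update-other : v ≢ y → (S [ y ↦ b ]) v ≡ S v
    update-other {v = v} {y = y} h with v ≟ y
    ... | yes p = ⊥-elim (h p)
    ... | no _  = refl

  ∪-⊆ : S ⊆ U → Q ⊆ U → (S ∪ Q) ⊆ U
  ∪-⊆ f g v h with ∪⁻ h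
  ... | inj₁ p = f v p
  ... | inj₂ p = g v p

  ∉⁅⁆⁻ : ⁅ y ⁆ v ≡ false → v ≢ y
  ∉⁅⁆⁻ h refl = absurd ⁅⁆-self h

  ∖⁅⁆⁻ : (S ∖ ⁅ y ⁆) v ≡ true → S v ≡ true × v ≢ y
  ∖⁅⁆⁻ h = proj₁ (∖⁻ h) , ∉⁅⁆⁻ (proj₂ (∖⁻ h))

  ∖⁅⁆⁺ : S v ≡ true → v ≢ y → (S ∖ ⁅ y ⁆) v ≡ true
  ∖⁅⁆⁺ h g = ∖⁺ h (⁅⁆-≢ g)

  ≢true⇒false : ∀ {b} → b ≢ true → b ≡ false
  ≢true⇒false {true}  h = ⊥-elim (h refl)
  ≢true⇒false {false} h = refl

  𝟙 : Bool → ℕ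
  𝟙 true  = 1
  𝟙 false = 0

  𝟙-mono : ∀ {a c} → (a ≡ true → c ≡ true) → 𝟙 a ≤ 𝟙 c
  𝟙-mono {false} h = z≤n
  𝟙-mono {true} {true} h = ≤-refl
  𝟙-mono {true} {false} h with h refl
  ... | ()

  𝟙-injective : ∀ {a c} → 𝟙 a ≡ 𝟙 c → a ≡ c
  𝟙-injective {true} {true} h = refl
  𝟙-injective {false} {false} h = refl

  sum-mono : {f g : Fin k → ℕ} → (∀ i → f i ≤ g i) → sum f ≤ sum g
  sum-mono {zero}  h = z≤n
  sum-mono {suc k} h = +-mono-≤ (h zero) (sum-mono (h ∘ suc))

  -- A strict inequality in one term could not be compensated elsewhere. This extracts the equality
  -- case of the double count in `closed⇒regularBipartite`.
  sum-≡⇒≗ : {f g : Fin k → ℕ} → (∀ i → f i ≤ g i) → sum g ≤ sum f → ∀ i → f i ≡ g i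
  sum-≡⇒≗ {f = f} {g} h t zero = ≤-antisym (h zero)
    (+-cancelʳ-≤ (sum (f ∘ suc)) _ _ (≤-trans (+-monoʳ-≤ (g zero) (sum-mono (h ∘ suc))) t))
  sum-≡⇒≗ {f = f} {g} h t (suc i) = sum-≡⇒≗ (h ∘ suc)
    (+-cancelˡ-≤ (f zero) _ _ (≤-trans (+-monoˡ-≤ (sum (g ∘ suc)) (h zero)) t)) i

  sum-zero : {f : Fin k → ℕ} → (∀ i → f i ≡ 0) → sum f ≡ 0
  sum-zero {zero}  h = refl
  sum-zero {suc k} h = cong₂ _+_ (h zero) (sum-zero (h ∘ suc))

  sum-single : {f : Fin k → ℕ} (p : Fin k) → (∀ i → i ≢ p → f i ≡ 0) → sum f ≡ f p
  sum-single {f = f} zero h =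
    trans (cong (f zero +_) (sum-zero (λ i → h (suc i) (λ ())))) (+-identityʳ _)
  sum-single (suc p) h =
    cong₂ _+_ (h zero (λ ())) (sum-single p (λ i ne → h (suc i) (λ { refl → ne refl })))

  opaque
    unfolding _∪_

    card : BSet k → ℕ
    card S = sum (λ v → 𝟙 (S v))

    card-def : (S : BSet k) → card S ≡ sum (λ v → 𝟙 (S v))
    card-def S = refl

    card-cong : (∀ v → S v ≡ Q v) → card S ≡ card Q
    card-cong h = sum-cong-≗ (λ i → cong 𝟙 (h i))

    card-mono : S ⊆ Q → card S ≤ card Q
    card-mono h = sum-mono (λ i → 𝟙-mono (h i))

    card≤ : (S : BSet k) → card S ≤ k
    card≤ {zero}  S = z≤n
    card≤ {suc k} S = +-mono-≤ (𝟙≤1 (S zero)) (card≤ (S ∘ suc))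
      where
      𝟙≤1 : ∀ b → 𝟙 b ≤ 1
      𝟙≤1 true  = ≤-refl
      𝟙≤1 false = z≤n

    card-∪-∩ : (S Q : BSet k) → card (S ∪ Q) + card (S ∩ Q) ≡ card S + card Q
    card-∪-∩ S Q =
      trans (sym (∑-distrib-+ (λ v → 𝟙 (S v ∨ Q v)) (λ v → 𝟙 (S v ∧ Q v))))
      (trans (sum-cong-≗ (λ i → lemma (S i) (Q i)))
             (∑-distrib-+ (λ v → 𝟙 (S v)) (λ v → 𝟙 (Q v))))
      where
      lemma : ∀ a c → 𝟙 (a ∨ c) + 𝟙 (a ∧ c) ≡ 𝟙 a + 𝟙 c
      lemma true  true  = refl
      lemma true  false = refl
      lemma false true  = refl
      lemma false false = refl

    card-split : (S U : BSet k) → card (S ∩ U) + card (S ∖ U) ≡ card S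
    card-split S U =
      trans (sym (∑-distrib-+ (λ v → 𝟙 (S v ∧ U v)) (λ v → 𝟙 (S v ∧ not (U v)))))
            (sum-cong-≗ (λ i → lemma (S i) (U i)))
      where
      lemma : ∀ a c → 𝟙 (a ∧ c) + 𝟙 (a ∧ not c) ≡ 𝟙 a
      lemma true  true  = refl
      lemma true  false = refl
      lemma false c     = refl

    card-⁅⁆ : (y : Fin k) → card ⁅ y ⁆ ≡ 1
    card-⁅⁆ y = trans (sum-single y (λ i ne → cong 𝟙 (⁅⁆-≢ ne))) (cong 𝟙 (⁅⁆-self {y = y}))

    card⇒member : (S : BSet k) → 1 ≤ card S → ∃[ y ] S y ≡ true
    card⇒member {suc k} S h with true? (S zero)
    ... | inj₁ p = zero , p
    ... | inj₂ p with card⇒member (S ∘ suc) (subst (λ b → 1 ≤ 𝟙 b + card (S ∘ suc)) p h)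
    ... | i , q = suc i , q

  card-remove : S y ≡ true → card S ≡ suc (card (S ∖ ⁅ y ⁆))
  card-remove {S = S} {y = y} h = trans (sym (card-split S ⁅ y ⁆)) (cong (_+ card (S ∖ ⁅ y ⁆))
    (trans (≤-antisym (card-mono (λ v p → proj₂ (∩⁻ p))) (card-mono lemma)) (card-⁅⁆ y)))
    where
    lemma : ⁅ y ⁆ ⊆ (S ∩ ⁅ y ⁆)
    lemma v p with ⁅⁆⁻ p
    ... | refl = ∩⁺ h p

  member⇒card : S y ≡ true → 1 ≤ card S
  member⇒card {S = S} h = ≤-trans (s≤s z≤n) (≤-reflexive (sym (card-remove {S = S} h)))

  card-< : S ⊆ Q → Q y ≡ true → S y ≡ false → card S < card Q
  card-< {S = S} {Q = Q} {y = y} sub q s =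
    ≤-trans (s≤s (card-mono λ v p → ∖⁅⁆⁺ {S = Q} (sub v p) (λ { refl → absurd p s })))
    (≤-reflexive (sym (card-remove {S = Q} q)))

  card-insert-≤ : (S : BSet k) (y : Fin k) → card (S ∪ ⁅ y ⁆) ≤ suc (card S)
  card-insert-≤ S y = ≤-trans (m≤m+n _ _) (≤-reflexive
    (trans (card-∪-∩ S ⁅ y ⁆) (trans (cong (card S +_) (card-⁅⁆ y)) (+-comm (card S) 1))))

  card-insert-> : S y ≡ false → card S < card (S ∪ ⁅ y ⁆)
  card-insert-> {S = S} {y = y} h =
    card-< {y = y} (λ v p → ∪⁺ˡ {S = S} p) (∪⁺ʳ {S = S} (⁅⁆-self {y = y})) h

  -- Boolean functions are enumerated only up to pointwise equality, through vectors, which is why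
  -- `P` has to respect it.
  searchSet : {P : BSet k → Set} → (∀ {S Q} → (∀ v → S v ≡ Q v) → P S → P Q) →
    (∀ S → Dec (P S)) → Dec (∃ P)
  searchSet resp P? = map′ (λ (s , p) → lookup s , p)
    (λ (S , p) → tabulate S , resp (λ v → sym (lookup∘tabulate S v)) p)
    (anySubset? (λ s → P? (lookup s)))

  -- Minimality is claimed against single deletions only, so greedy deletion is enough, with `card`
  -- bounding the number of rounds.
  minimalSet : {P : BSet k → Set} → (∀ S → Dec (P S)) → ∀ S → P S →
    ∃[ F ] (P F × F ⊆ S × (∀ e → F e ≡ true → ¬ P (F ∖ ⁅ e ⁆)))
  minimalSet {k} {P} P? S p = go (card S) S ≤-refl p
    where
    go : ∀ c S → card S ≤ c → P S → ∃[ F ] (P F × F ⊆ S × (∀ e → F e ≡ true → ¬ P (F ∖ ⁅ e ⁆)))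
    go c S le p with any? (λ e → del? e)
      where
      del? : ∀ e → Dec (S e ≡ true × P (S ∖ ⁅ e ⁆))
      del? e with true? (S e) | P? (S ∖ ⁅ e ⁆)
      ... | inj₁ a | yes b = yes (a , b)
      ... | inj₁ a | no ¬b = no (¬b ∘ proj₂)
      ... | inj₂ a | _     = no (λ z → absurd (proj₁ z) a)
    ... | no ¬d = S , p , (λ _ → id) , (λ e a b → ¬d (e , a , b))
    go zero S le p | yes (e , a , _) = ⊥-elim (n≮0 (≤-trans (member⇒card {S = S} a) le))
    go (suc c) S le p | yes (e , a , b)
      with go c (S ∖ ⁅ e ⁆) (s≤s⁻¹ (≤-trans (≤-reflexive (sym (card-remove {S = S} a))) le)) b
    ... | F , pF , sub , mn = F , pF , (λ v q → proj₁ (∖⁻ (sub v q))) , mn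

open FiniteSets

-- Connectivity expressed by cuts, and its translation to walks.

module Cuts (G : Graph) where

  V = Vertex G
  VSet = BSet (n G)
  ESet = BSet (m G)

  private variable
    e : Edge G
    u v w x y : V
    es fs : List (Edge G)

  Joins-ends : ∀ e → Joins G e (proj₁ (ends G e)) (proj₂ (ends G e))
  Joins-ends e = inj₁ refl

  Joins-≢ : Joins G e u v → u ≢ v
  Joins-≢ {e = e} (inj₁ refl) p = loopless G e p
  Joins-≢ {e = e} (inj₂ refl) p = loopless G e (sym p)

  Joins-unique : Joins G e u v → Joins G e x y → (u ≡ x × v ≡ y) ⊎ (u ≡ y × v ≡ x)
  Joins-unique (inj₁ refl) (inj₁ refl) = inj₁ (refl , refl)
  Joins-unique (inj₁ refl) (inj₂ refl) = inj₂ (refl , refl)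
  Joins-unique (inj₂ refl) (inj₁ refl) = inj₂ (refl , refl)
  Joins-unique (inj₂ refl) (inj₂ refl) = inj₁ (refl , refl)

  Joins? : ∀ e u v → Dec (Joins G e u v)
  Joins? e u v = ≡-dec _≟_ _≟_ _ _ ⊎-dec ≡-dec _≟_ _≟_ _ _

  -- The edge leaves `U` from `p` to `q`. The relation `R` restricts it to an edge set (`InE`), to a
  -- vertex set (`Within`) or to the complement of a vertex (`Avoids`).
  Cross : (Edge G → V → V → Set) → VSet → Set
  Cross R U = ∃[ e ] ∃[ p ] ∃[ q ] (Joins G e p q × R e p q × U p ≡ true × U q ≡ false)

  cross? : {R : Edge G → V → V → Set} → (∀ e p q → Dec (R e p q)) → ∀ U → Dec (Cross R U)
  cross? R? U = any? λ e → any? λ p → any? λ q →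
    Joins? e p q ×-dec R? e p q ×-dec (U p ≟ᵇ true) ×-dec (U q ≟ᵇ false)

  InE : ESet → Edge G → V → V → Set
  InE E e _ _ = E e ≡ true

  -- Connectedness by cuts: it is decided by searching for a bad cut, and a missing crossing edge is
  -- exactly what the counting arguments exploit.
  Conn : ESet → Set
  Conn E = ∀ U {a b} → U a ≡ true → U b ≡ false → Cross (InE E) U

  conn? : ∀ E → Dec (Conn E)
  conn? E = map′
    (λ ¬s U {a} {b} p q → decidable-stable (c? U) (λ ¬c → ¬s (U , (a , p) , (b , q) , ¬c)))
    (λ { c (U , (a , p) , (b , q) , ¬c) → ¬c (c U p q) })
    (¬? (searchSet respects (λ U → any? (λ a → U a ≟ᵇ true) ×-dec any? (λ b → U b ≟ᵇ false)
      ×-dec ¬? (c? U))))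
    where
    c? : ∀ U → Dec (Cross (InE E) U)
    c? = cross? (λ e _ _ → E e ≟ᵇ true)
    respects : ∀ {S Q : VSet} → (∀ v → S v ≡ Q v) →
      (∃[ a ] S a ≡ true) × (∃[ b ] S b ≡ false) × ¬ Cross (InE E) S →
      (∃[ a ] Q a ≡ true) × (∃[ b ] Q b ≡ false) × ¬ Cross (InE E) Q
    respects h ((a , p) , (b , q) , ¬c) = (a , trans (sym (h a)) p) , (b , trans (sym (h b)) q) ,
      λ { (e , p , q , j , i , s , t) → ¬c (e , p , q , j , i , trans (h p) s , trans (h q) t) }

  private variable E : ESet

  _++ʷ_ : Walk G E u v es → Walk G E v w fs → Walk G E u w (es ++ fs)
  nil          ++ʷ z = z
  cons e i j y ++ʷ z = cons e i j (y ++ʷ z)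

  reverseʷ : ∀ {ℓ} {P : Edge G → Set ℓ} → Walk G E u v es → All P es →
    ∃[ fs ] (Walk G E v u fs × All P fs)
  reverseʷ nil [] = [] , nil , []
  reverseʷ (cons e i j z) (p ∷ ps) with reverseʷ z ps
  ... | fs , z′ , ps′ = fs ++ e ∷ [] , z′ ++ʷ cons e i (swap j) nil , ++⁺ ps′ (p ∷ [])

  walk-cross : ∀ {U : VSet} → Walk G E u v es → U u ≡ true → U v ≡ false →
    Cross (λ e _ _ → e ∈ˡ es × E e ≡ true) U
  walk-cross nil p q = absurd p q
  walk-cross {U = U} (cons {v = c} e i j z) p q with true? (U c)
  ... | inj₂ r = e , _ , c , j , (here refl , i) , p , r
  ... | inj₁ r with walk-cross z r q
  ... | f , a , b , k , (l , h) , s , t = f , a , b , k , (there l , h) , s , t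

  Connected⇒Conn : Connected G E → Conn E
  Connected⇒Conn c U {a} {b} p q with walk-cross (proj₂ (c a b)) p q
  ... | e , a′ , b′ , j , (_ , i) , s , t = e , a′ , b′ , j , i , s , t

  -- The set of vertices known to be reachable from `u` keeps gaining the outer end of an exit edge
  -- until it contains `v`.
  Conn⇒Connected : Conn E → Connected G E
  Conn⇒Connected {E = E} c u v = go (n G) ⁅ u ⁆ (m≤n+m _ _) ⁅⁆-self init
    where
    init : ∀ a → ⁅ u ⁆ a ≡ true → ∃[ es ] Walk G E u a es
    init a h with ⁅⁆⁻ h
    ... | refl = [] , nil
    -- `k` bounds the number of vertices outside `U`; at zero no exit edge can exist.
    go : ∀ k U → n G ≤ card U + k → U u ≡ true →
      (∀ a → U a ≡ true → ∃[ es ] Walk G E u a es) → ∃[ es ] Walk G E u v es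
    go k U le hu reach with true? (U v)
    ... | inj₁ h = reach v h
    ... | inj₂ h with c U hu h
    go zero U le hu reach | inj₂ h | e , p , q , j , i , s , t =
      ⊥-elim (<-irrefl refl (≤-trans (s≤s (≤-trans le (≤-reflexive (+-identityʳ _))))
        (≤-trans (card-insert-> {S = U} {y = q} t) (card≤ _))))
    go (suc k) U le hu reach | inj₂ h | e , p , q , j , i , s , t =
      go k (U ∪ ⁅ q ⁆)
        (≤-trans le (≤-trans (≤-reflexive (+-suc _ k)) (+-monoˡ-≤ k (card-insert-> t))))
        (∪⁺ˡ hu) reach′
      where
      reach′ : ∀ a → (U ∪ ⁅ q ⁆) a ≡ true → ∃[ es ] Walk G E u a es
      reach′ a r with ∪⁻ r
      ... | inj₁ r′ = reach a r′
      ... | inj₂ r′ with ⁅⁆⁻ r′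
      ... | refl with reach p s
      ... | es , z = es ++ e ∷ [] , z ++ʷ cons e i j nil

  -- Degrees and double counting.

  incident⁺ : Joins G e v x → incident G v e ≡ true
  incident⁺ {e = e} {v = v} (inj₁ refl) with v ≟ v
  ... | yes _ = refl
  ... | no ¬p = ⊥-elim (¬p refl)
  incident⁺ {e = e} {v = v} {x = x} (inj₂ refl) with x ≟ v | v ≟ v
  ... | yes _ | _ = refl
  ... | no _ | yes _ = refl
  ... | no _ | no ¬p = ⊥-elim (¬p refl)

  degIn-card : ∀ E v → degIn G E v ≡ card (λ e → E e ∧ incident G v e)
  degIn-card E v = trans (lemma (λ e → E e ∧ incident G v e) id) (sym (card-def _))
    where
    lemma : ∀ {k} (f : ESet) (g : Fin k → Edge G) →
      length (filter (λ e → f e ≟ᵇ true) (List.tabulate g)) ≡ sum (λ i → 𝟙 (f (g i)))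
    lemma {zero} f g = refl
    lemma {suc k} f g with f (g zero)
    ... | true  = cong suc (lemma f (g ∘ suc))
    ... | false = lemma f (g ∘ suc)

  deg≤Δ : ∀ v → deg G v ≤ Δ G
  deg≤Δ v = bound (∈-allFin v)
    where
    bound : ∀ {vs} → v ∈ˡ vs → deg G v ≤ foldr _⊔_ 0 (map (deg G) vs)
    bound (here refl) = m≤m⊔n _ _
    bound {u ∷ vs} (there h) = ≤-trans (bound h) (m≤n⊔m (deg G u) _)

  -- Exchanging the order of summation counts, at each edge, its ends in `S`; as there are no loops,
  -- the two ends contribute separately.
  weightedDegrees : (S : VSet) → sum (λ v → 𝟙 (S v) * deg G v) ≡
    sum (λ e → 𝟙 (S (proj₁ (ends G e))) + 𝟙 (S (proj₂ (ends G e))))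
  weightedDegrees S = trans (sum-cong-≗ expand) (trans (∑-comm (λ v e → 𝟙 (S v) * I v e)) (sum-cong-≗ collapse))
    where
    I : V → Edge G → ℕ
    I v e = 𝟙 (incident G v e)
    expand : ∀ v → 𝟙 (S v) * deg G v ≡ sum (λ e → 𝟙 (S v) * I v e)
    expand v = trans (cong (𝟙 (S v) *_) (trans (degIn-card _ v) (card-def _))) (*-distribˡ-sum (𝟙 (S v)) (I v))
    split : ∀ e v → 𝟙 (S v) * I v e ≡
      𝟙 (S v) * 𝟙 ⌊ proj₁ (ends G e) ≟ v ⌋ + 𝟙 (S v) * 𝟙 ⌊ proj₂ (ends G e) ≟ v ⌋
    split e v with proj₁ (ends G e) ≟ v | proj₂ (ends G e) ≟ v
    ... | yes p | yes q = ⊥-elim (loopless G e (trans p (sym q)))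
    ... | yes p | no _  = trans (sym (+-identityʳ _)) (cong (𝟙 (S v) * 1 +_) (sym (*-zeroʳ (𝟙 (S v)))))
    ... | no _  | yes q = cong (_+ 𝟙 (S v) * 1) (sym (*-zeroʳ (𝟙 (S v))))
    ... | no _  | no _  = trans (*-zeroʳ (𝟙 (S v))) (sym (cong₂ _+_ (*-zeroʳ (𝟙 (S v))) (*-zeroʳ (𝟙 (S v)))))
    pick : ∀ p → sum (λ v → 𝟙 (S v) * 𝟙 ⌊ p ≟ v ⌋) ≡ 𝟙 (S p)
    pick p = trans (sum-single p off) on
      where
      off : ∀ v → v ≢ p → 𝟙 (S v) * 𝟙 ⌊ p ≟ v ⌋ ≡ 0
      off v ne with p ≟ v
      ... | yes refl = ⊥-elim (ne refl)
      ... | no _ = *-zeroʳ (𝟙 (S v))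
      on : 𝟙 (S p) * 𝟙 ⌊ p ≟ p ⌋ ≡ 𝟙 (S p)
      on with p ≟ p
      ... | yes _ = *-identityʳ _
      ... | no ¬p = ⊥-elim (¬p refl)
    collapse : ∀ e → sum (λ v → 𝟙 (S v) * I v e) ≡
      𝟙 (S (proj₁ (ends G e))) + 𝟙 (S (proj₂ (ends G e)))
    collapse e = trans (sum-cong-≗ (split e)) (trans
      (∑-distrib-+ (λ v → 𝟙 (S v) * 𝟙 ⌊ proj₁ (ends G e) ≟ v ⌋) (λ v → 𝟙 (S v) * 𝟙 ⌊ proj₂ (ends G e) ≟ v ⌋))
      (cong₂ _+_ (pick _) (pick _)))

  -- Δ|S| is the number of edge ends in `S`, which is at most the number in `Q`, hence at most Δ|Q|
  -- and so at most Δ|S|. Equality throughout gives every vertex of `Q` degree Δ and sends every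
  -- edge at `Q` back to `S`. Then no edge leaves `S ∪ Q`, which is therefore everything.
  closed⇒regularBipartite : Conn (allEdges G) → (S Q : VSet) → ∃[ s ] S s ≡ true →
    (∀ v → S v ≡ true → deg G v ≡ Δ G) → (∀ v → S v ≡ true → Q v ≡ true → ⊥) →
    (∀ e u v → Joins G e u v → S u ≡ true → Q v ≡ true) → card Q ≤ card S → RegularBipartite G
  closed⇒regularBipartite conn S Q (s , hs) crit disj nbr le =
    (Δ G , λ v → case-deg v (everything v)) , (S , proper)
    where
    endsIn : VSet → Edge G → ℕ
    endsIn S e = 𝟙 (S (proj₁ (ends G e))) + 𝟙 (S (proj₂ (ends G e)))
    fst : ∀ e → 𝟙 (S (proj₁ (ends G e))) ≤ 𝟙 (Q (proj₂ (ends G e)))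
    snd : ∀ e → 𝟙 (S (proj₂ (ends G e))) ≤ 𝟙 (Q (proj₁ (ends G e)))
    fst e = 𝟙-mono (nbr e _ _ (Joins-ends e))
    snd e = 𝟙-mono (nbr e _ _ (swap (Joins-ends e)))
    ends≤ : ∀ e → endsIn S e ≤ endsIn Q e
    ends≤ e = ≤-trans (+-mono-≤ (fst e) (snd e)) (≤-reflexive (+-comm (𝟙 (Q (proj₂ (ends G e)))) _))
    degS : sum (λ v → 𝟙 (S v) * deg G v) ≡ card S * Δ G
    degS = trans (sum-cong-≗ pt) (trans (sym (*-distribʳ-sum (Δ G) (λ v → 𝟙 (S v)))) (cong (_* Δ G) (sym (card-def S))))
      where
      pt : ∀ v → 𝟙 (S v) * deg G v ≡ 𝟙 (S v) * Δ G
      pt v with true? (S v)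
      ... | inj₁ h = cong (𝟙 (S v) *_) (crit v h)
      ... | inj₂ h rewrite h = refl
    QΔ : sum (λ v → 𝟙 (Q v) * Δ G) ≤ sum (endsIn S)
    QΔ = ≤-trans (≤-reflexive (trans (sym (*-distribʳ-sum (Δ G) (λ v → 𝟙 (Q v)))) (cong (_* Δ G) (sym (card-def Q)))))
      (≤-trans (*-monoˡ-≤ (Δ G) le) (≤-reflexive (trans (sym degS) (weightedDegrees S))))
    degQ≤ : ∀ v → 𝟙 (Q v) * deg G v ≤ 𝟙 (Q v) * Δ G
    degQ≤ v = *-monoʳ-≤ (𝟙 (Q v)) (deg≤Δ v)
    ends≡ : ∀ e → endsIn S e ≡ endsIn Q e
    ends≡ = sum-≡⇒≗ ends≤ (≤-trans (≤-reflexive (sym (weightedDegrees Q))) (≤-trans (sum-mono degQ≤) QΔ))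
    degQ≡ : ∀ v → 𝟙 (Q v) * deg G v ≡ 𝟙 (Q v) * Δ G
    degQ≡ = sum-≡⇒≗ degQ≤ (≤-trans QΔ (≤-trans (sum-mono ends≤) (≤-reflexive (sym (weightedDegrees Q)))))
    -- Each end in `S` is dominated by the opposite end in `Q`, so equality of the two sums at an
    -- edge forces both comparisons to be equalities.
    ends-swap : ∀ e → S (proj₁ (ends G e)) ≡ Q (proj₂ (ends G e)) × S (proj₂ (ends G e)) ≡ Q (proj₁ (ends G e))
    ends-swap e = 𝟙-injective (≤-antisym (fst e) (+-cancelʳ-≤ (𝟙 (Q (proj₁ (ends G e)))) _ _
                (≤-trans (≤-reflexive tot) (+-monoʳ-≤ _ (snd e)))))
            , 𝟙-injective (≤-antisym (snd e) (+-cancelˡ-≤ (𝟙 (Q (proj₂ (ends G e)))) _ _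
                (≤-trans (≤-reflexive tot) (+-monoˡ-≤ _ (fst e)))))
      where
      tot : 𝟙 (Q (proj₂ (ends G e))) + 𝟙 (Q (proj₁ (ends G e))) ≡ endsIn S e
      tot = trans (+-comm (𝟙 (Q (proj₂ (ends G e)))) _) (sym (ends≡ e))
    back : ∀ {e u v} → Joins G e u v → Q u ≡ true → S v ≡ true
    back {e} (inj₁ refl) h = trans (proj₂ (ends-swap e)) h
    back {e} (inj₂ refl) h = trans (proj₁ (ends-swap e)) h
    everything : ∀ v → (S ∪ Q) v ≡ true
    everything v with true? ((S ∪ Q) v)
    ... | inj₁ h = h
    ... | inj₂ h with conn (S ∪ Q) (∪⁺ˡ hs) h
    ... | e , p , q , j , _ , i , o with ∪⁻ i
    ... | inj₁ i′ = absurd (∪⁺ʳ (nbr e p q j i′)) o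
    ... | inj₂ i′ = absurd (∪⁺ˡ (back j i′)) o
    case-deg : ∀ v → (S ∪ Q) v ≡ true → deg G v ≡ Δ G
    case-deg v h with ∪⁻ h
    ... | inj₁ p = crit v p
    ... | inj₂ p = trans (sym (+-identityʳ _)) (trans (subst (λ b → 𝟙 b * deg G v ≡ 𝟙 b * Δ G) p (degQ≡ v)) (+-identityʳ _))
    proper : ProperOn G (allEdges G) S
    proper e _ same with true? (S (proj₁ (ends G e))) | ∪⁻ (everything (proj₁ (ends G e)))
    ... | inj₁ h | _ = disj _ (trans (sym same) h) (nbr e _ _ (Joins-ends e) h)
    ... | inj₂ h | inj₁ h′ = absurd h′ h
    ... | inj₂ h | inj₂ h′ = absurd (back {e} (Joins-ends e) h′) (trans (sym same) h)

-- Tight pairs and bichromatic edges.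

module Tightness (G : Graph) where
  open Cuts G

  -- `Q` need only contain the neighbourhood of `S`. With this slack, unions and intersections of
  -- covers are covers again.
  Covers : ESet → VSet → VSet → Set
  Covers E S Q = ∀ e y x → E e ≡ true → Joins G e y x → S y ≡ true → Q x ≡ true

  -- Such a pair witnesses the failure of |N(S)| > |S| for some nonempty S ⊆ K.
  Tight : ESet → VSet → VSet → VSet → Set
  Tight E K S Q = (∃[ s ] S s ≡ true) × S ⊆ K × Covers E S Q × card Q ≤ card S

  tight? : ∀ E K S Q → Dec (Tight E K S Q)
  tight? E K S Q = any? (λ s → S s ≟ᵇ true)
    ×-dec all? (λ v → (S v ≟ᵇ true) →-dec (K v ≟ᵇ true))
    ×-dec all? (λ e → all? λ y → all? λ x →
      (E e ≟ᵇ true) →-dec Joins? e y x →-dec (S y ≟ᵇ true) →-dec (Q x ≟ᵇ true))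
    ×-dec (card Q ≤? card S)

  HasTight : ESet → VSet → Set
  HasTight E K = ∃[ S ] ∃[ Q ] Tight E K S Q

  tight-respects : ∀ {E K S S′ Q Q′} → (∀ v → S v ≡ S′ v) → (∀ v → Q v ≡ Q′ v) →
    Tight E K S Q → Tight E K S′ Q′
  tight-respects f g ((s , h) , sub , cov , le) = (s , trans (sym (f s)) h) ,
    (λ v p → sub v (trans (f v) p)) ,
    (λ e y x i j p → trans (sym (g x)) (cov e y x i j (trans (f y) p))) ,
    subst₂ _≤_ (card-cong g) (card-cong f) le

  -- `P` sees sizes only, so it respects pointwise equality. It is trivial when any tight pair will
  -- do, and a size bound when a smaller one is sought.
  searchTight : ∀ {E K} {P : ℕ → ℕ → Set} → (∀ i j → Dec (P i j)) →
    Dec (∃[ S ] ∃[ Q ] (Tight E K S Q × P (card S) (card Q)))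
  searchTight {E} {K} {P} P? = searchSet
    (λ { f (Q , t , p) → Q , tight-respects f (λ _ → refl) t , subst (λ i → P i (card Q)) (card-cong f) p })
    (λ S → searchSet
      (λ { g (t , p) → tight-respects (λ _ → refl) g t , subst (P (card S)) (card-cong g) p })
      (λ Q → tight? E K S Q ×-dec P? (card S) (card Q)))

  opaque
    hasTight? : ∀ E K → Dec (HasTight E K)
    hasTight? E K = map′ (λ { (S , Q , t , _) → S , Q , t }) (λ { (S , Q , t) → S , Q , t , z≤n })
      (searchTight {P = λ _ _ → 0 ≤ 0} (λ _ _ → yes z≤n))

  -- Minimising the sum of the sizes controls both sides at once: `Q` shrinks to the exact
  -- neighbourhood of `S`, and smaller pairs inside `S` expand strictly.
  MinimalTight : ESet → VSet → VSet → VSet → Set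
  MinimalTight E K S Q = Tight E K S Q ×
    (∀ S′ Q′ → Tight E K S′ Q′ → card S + card Q ≤ card S′ + card Q′)

  minimalTight : ∀ {E K} → HasTight E K → ∃[ S ] ∃[ Q ] MinimalTight E K S Q
  minimalTight {E} {K} (S , Q , t) = go _ S Q ≤-refl t
    where
    go : ∀ k S Q → card S + card Q ≤ k → Tight E K S Q → ∃[ S ] ∃[ Q ] MinimalTight E K S Q
    go k S Q le t with searchTight {E} {K} {P = λ i j → i + j < card S + card Q} (λ i j → suc (i + j) ≤? _)
    ... | no ¬p = S , Q , t , λ S′ Q′ t′ → ≮⇒≥ (λ lt → ¬p (S′ , Q′ , t′ , lt))
    go zero S Q le t | yes (S′ , Q′ , t′ , lt) = ⊥-elim (n≮0 (≤-trans lt le))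
    go (suc k) S Q le t | yes (S′ , Q′ , t′ , lt) = go k S′ Q′ (s≤s⁻¹ (≤-trans lt le)) t′

  opaque
    bichromatic : VSet → ESet
    bichromatic col e = not ⌊ col (proj₁ (ends G e)) ≟ᵇ col (proj₂ (ends G e)) ⌋

    bichromatic⁺ : ∀ {col e u v} → Joins G e u v → col u ≢ col v → bichromatic col e ≡ true
    bichromatic⁺ {col} {e} j ne with col (proj₁ (ends G e)) ≟ᵇ col (proj₂ (ends G e))
    ... | no _ = refl
    bichromatic⁺ (inj₁ refl) ne | yes p = ⊥-elim (ne p)
    bichromatic⁺ (inj₂ refl) ne | yes p = ⊥-elim (ne (sym p))

    bichromatic⁻ : ∀ {col e u v} → Joins G e u v → bichromatic col e ≡ true → col u ≢ col v
    bichromatic⁻ {col} {e} j h with col (proj₁ (ends G e)) ≟ᵇ col (proj₂ (ends G e))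
    bichromatic⁻ (inj₁ refl) h | no ne = ne
    bichromatic⁻ (inj₂ refl) h | no ne = ne ∘ sym

  module _ {col : VSet} where
    true⇒false : ∀ {e u v} → bichromatic col e ≡ true → Joins G e u v → col u ≡ true → col v ≡ false
    true⇒false h j p = ≢true⇒false (λ q → bichromatic⁻ {col} j h (trans p (sym q)))

    false⇒true : ∀ {e u v} → bichromatic col e ≡ true → Joins G e u v → col u ≡ false → col v ≡ true
    false⇒true {v = v} h j p with true? (col v)
    ... | inj₁ q = q
    ... | inj₂ q = ⊥-elim (bichromatic⁻ {col} j h (trans p (sym q)))

    same-edge : ∀ {e y x s z} → bichromatic col e ≡ true → Joins G e y x → Joins G e s z →
      col y ≡ true → col s ≡ true → s ≡ y × z ≡ x
    same-edge h j j′ p q with Joins-unique j j′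
    ... | inj₁ (refl , refl) = refl , refl
    ... | inj₂ (refl , refl) = absurd q (true⇒false h j p)

-- Lovász's forest from the strict Hall condition.

module HallTree (G : Graph) (col K : Cuts.VSet G) (K⊆ : K ⊆ col)
  (conn : Cuts.Conn G (Tightness.bichromatic G col))
  (hall : ¬ Tightness.HasTight G (Tightness.bichromatic G col) K) where
  open Cuts G
  open Tightness G

  private variable
    e f g : Edge G
    c d s u v x y z : V
    es : List (Edge G)

  H : ESet
  H = bichromatic col

  opaque
    touching : ESet
    touching e = K (proj₁ (ends G e)) ∨ K (proj₂ (ends G e))

    touching⁺ : Joins G e y x → K y ≡ true → touching e ≡ true
    touching⁺ (inj₁ refl) h rewrite h = refl
    touching⁺ {e} (inj₂ refl) h with K (proj₁ (ends G e))
    ... | true = refl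
    ... | false = h

    touching⁻ : touching e ≡ true → Joins G e y x → K y ≡ true ⊎ K x ≡ true
    touching⁻ {e} h (inj₁ refl) with K (proj₁ (ends G e))
    ... | true = inj₁ refl
    ... | false = inj₂ h
    touching⁻ {e} h (inj₂ refl) with K (proj₁ (ends G e))
    ... | true = inj₂ refl
    ... | false = inj₁ h

  opaque
    -- Edges are deleted as long as strict expansion survives. Starting from the edges that meet `K`
    -- is harmless, since tight pairs see only edges with an end in `S ⊆ K`.
    minimalHall : ∃[ F ] (¬ HasTight F K × F ⊆ (H ∩ touching) ×
      (∀ e → F e ≡ true → ¬ ¬ HasTight (F ∖ ⁅ e ⁆) K))
    minimalHall = minimalSet {P = λ E → ¬ HasTight E K} (λ E → ¬? (hasTight? E K)) (H ∩ touching)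
      λ { (S , Q , ne , sub , cov , le) → hall (S , Q , ne , sub ,
        (λ e y x i j p → cov e y x (∩⁺ i (touching⁺ j (sub y p))) j p) , le) }

  F : ESet
  F = proj₁ minimalHall

  F-hall : ¬ HasTight F K
  F-hall = proj₁ (proj₂ minimalHall)

  F⊆H : F ⊆ H
  F⊆H e h = proj₁ (∩⁻ (proj₁ (proj₂ (proj₂ minimalHall)) e h))

  F⊆touching : F ⊆ touching
  F⊆touching e h = proj₂ (∩⁻ (proj₁ (proj₂ (proj₂ minimalHall)) e h))

  F-minimal : F e ≡ true → HasTight (F ∖ ⁅ e ⁆) K
  F-minimal {e} h = decidable-stable (hasTight? _ K) (proj₂ (proj₂ (proj₂ minimalHall)) e h)

  F-same : F e ≡ true → K y ≡ true → K s ≡ true → Joins G e y x → Joins G e s z → s ≡ y × z ≡ x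
  F-same h p q j j′ = same-edge {col} (F⊆H _ h) j j′ (K⊆ _ p) (K⊆ _ q)

  -- If e₁ and e₂ are both indispensable, uncrossing their tight pairs shows that no other edge of F meets y.
  ≤2-edges : K y ≡ true → F e ≡ true → F f ≡ true → F g ≡ true → e ≢ f → g ≢ e → g ≢ f →
    Joins G e y x → Joins G f y z → Joins G g y u → ⊥
  ≤2-edges {y} {e₁} {e₂} {g} {x} {z} {u} Ky F₁ F₂ F₃ 1≢2 3≢1 3≢2 j₁ j₂ j₃
    with F-minimal F₁ | F-minimal F₂
  ... | S₁ , Q₁ , ne₁ , sub₁ , cov₁ , le₁ | S₂ , Q₂ , ne₂ , sub₂ , cov₂ , le₂ = <-irrefl refl (begin-strict
    card (S₁ ∪ S₂) + card (S₁ ∩ S₂)       ≡⟨ cong (card (S₁ ∪ S₂) +_) (card-remove {S = S₁ ∩ S₂} (∩⁺ y∈S₁ y∈S₂)) ⟩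
    card (S₁ ∪ S₂) + suc (card S∩)        <⟨ +-mono-<-≤ ∪-strict ∩-strict ⟩
    card (Q₁ ∪ Q₂) + card (Q₁ ∩ Q₂)       ≡⟨ card-∪-∩ Q₁ Q₂ ⟩
    card Q₁ + card Q₂                     ≤⟨ +-mono-≤ le₁ le₂ ⟩
    card S₁ + card S₂                     ≡⟨ sym (card-∪-∩ S₁ S₂) ⟩
    card (S₁ ∪ S₂) + card (S₁ ∩ S₂)       ∎)
    where
    open ≤-Reasoning
    -- A tight pair that appears on deleting `e` must contain `y`, the only end of `e` in `K`;
    -- otherwise it would already be tight in `F`.
    at-y : ∀ {e x S Q} → F e ≡ true → Joins G e y x → S ⊆ K → (∃[ s ] S s ≡ true) →
      Covers (F ∖ ⁅ e ⁆) S Q → card Q ≤ card S → S y ≡ true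
    at-y {e} {S = S} {Q} Fe j sub ne cov le with true? (S y)
    ... | inj₁ p = p
    ... | inj₂ p = ⊥-elim (F-hall (S , Q , ne , sub , cov′ , le))
      where
      cov′ : Covers F S Q
      cov′ e′ s x′ h j′ q with e′ ≟ e
      ... | no e′≢e = cov e′ s x′ (∖⁅⁆⁺ h e′≢e) j′ q
      ... | yes refl = absurd (subst (λ v → S v ≡ true) (proj₁ (F-same h Ky (sub s q) j j′)) q) p
    y∈S₁ = at-y F₁ j₁ sub₁ ne₁ cov₁ le₁
    y∈S₂ = at-y F₂ j₂ sub₂ ne₂ cov₂ le₂
    -- Both deleted edges have `y` as their end in `K`, so without `y` the intersection is covered
    -- in all of `F`.
    S∩ = (S₁ ∩ S₂) ∖ ⁅ y ⁆
    -- The edge deleted for one pair is present for the other, which also contains `y`.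
    cover∪ : Covers F (S₁ ∪ S₂) (Q₁ ∪ Q₂)
    cover∪ e s x′ h j p with ∪⁻ p | e ≟ e₁ | e ≟ e₂
    ... | inj₁ q | no ≢1 | _ = ∪⁺ˡ (cov₁ e s x′ (∖⁅⁆⁺ h ≢1) j q)
    ... | inj₁ q | yes refl | _ = ∪⁺ʳ (cov₂ e s x′ (∖⁅⁆⁺ h 1≢2) j
      (subst (λ v → S₂ v ≡ true) (sym (proj₁ (F-same h Ky (sub₁ s q) j₁ j))) y∈S₂))
    ... | inj₂ q | _ | no ≢2 = ∪⁺ʳ (cov₂ e s x′ (∖⁅⁆⁺ h ≢2) j q)
    ... | inj₂ q | _ | yes refl = ∪⁺ˡ (cov₁ e s x′ (∖⁅⁆⁺ h (1≢2 ∘ sym)) j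
      (subst (λ v → S₁ v ≡ true) (sym (proj₁ (F-same h Ky (sub₂ s q) j₂ j))) y∈S₁))
    ∪-strict : card (S₁ ∪ S₂) < card (Q₁ ∪ Q₂)
    ∪-strict = ≰⇒> λ le → F-hall (_ , _ , (y , ∪⁺ˡ y∈S₁) , ∪-⊆ sub₁ sub₂ , cover∪ , le)
    cover∩ : Covers F S∩ (Q₁ ∩ Q₂)
    cover∩ e s x′ h j p with ∖⁅⁆⁻ p
    ... | q , s≢y with ∩⁻ q
    ... | q₁ , q₂ = ∩⁺
      (cov₁ e s x′ (∖⁅⁆⁺ h (λ { refl → s≢y (proj₁ (F-same h Ky (sub₁ s q₁) j₁ j)) })) j q₁)
      (cov₂ e s x′ (∖⁅⁆⁺ h (λ { refl → s≢y (proj₁ (F-same h Ky (sub₁ s q₁) j₂ j)) })) j q₂)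
    -- The third edge survives both deletions. Its end `u` makes the intersection inequality strict
    -- even when `S∩` is empty.
    u∈Q∩ : (Q₁ ∩ Q₂) u ≡ true
    u∈Q∩ = ∩⁺ (cov₁ g y u (∖⁅⁆⁺ F₃ 3≢1) j₃ y∈S₁) (cov₂ g y u (∖⁅⁆⁺ F₃ 3≢2) j₃ y∈S₂)
    ∩-strict : card S∩ < card (Q₁ ∩ Q₂)
    ∩-strict = ≰⇒> λ le → F-hall (_ , _ , card⇒member S∩ (≤-trans (member⇒card {S = Q₁ ∩ Q₂} u∈Q∩) le) ,
      (λ v p → sub₁ v (proj₁ (∩⁻ (proj₁ (∖⁅⁆⁻ p))))) , cover∩ , le)

  F-neighbour? : ∀ y x → Dec (∃[ e ] (F e ≡ true × Joins G e y x))
  F-neighbour? y x = any? λ e → (F e ≟ᵇ true) ×-dec Joins? e y x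

  F-neighbours : V → VSet
  F-neighbours y x = ⌊ F-neighbour? y x ⌋

  F-neighbours⁻ : F-neighbours y x ≡ true → ∃[ e ] (F e ≡ true × Joins G e y x)
  F-neighbours⁻ {y} {x} h with F-neighbour? y x
  ... | yes p = p

  -- Otherwise `y` alone would be tight with its neighbours. Counting neighbours, not edges, is what
  -- later yields a second edge even in the presence of parallel edges.
  ≥2-neighbours : K y ≡ true → 2 ≤ card (F-neighbours y)
  ≥2-neighbours {y} Ky = ≰⇒> λ le → F-hall
    (⁅ y ⁆ , _ , (y , ⁅⁆-self) , sub , cov , ≤-trans le (≤-reflexive (sym (card-⁅⁆ y))))
    where
    sub : ⁅ y ⁆ ⊆ K
    sub v p with ⁅⁆⁻ p
    ... | refl = Ky
    cov : Covers F ⁅ y ⁆ (F-neighbours y)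
    cov e s x h j p with ⁅⁆⁻ p
    ... | refl with F-neighbour? y x
    ... | yes _ = refl
    ... | no ¬p = ⊥-elim (¬p (e , h , j))

  other-edge : K y ≡ true → F e ≡ true → Joins G e y x →
    ∃[ f ] ∃[ z ] (F f ≡ true × Joins G f y z × f ≢ e)
  other-edge {y} {e} {x} Ky Fe j
    with card⇒member (F-neighbours y ∖ ⁅ x ⁆) (≤-trans (∸-monoˡ-≤ 1 (≥2-neighbours Ky)) lemma)
    where
    N = F-neighbours y
    lemma : card N ∸ 1 ≤ card (N ∖ ⁅ x ⁆)
    lemma with true? (N x)
    ... | inj₁ p = ≤-reflexive (cong (_∸ 1) (card-remove {S = N} p))
    ... | inj₂ p = ≤-trans (m∸n≤m (card N) 1)
      (card-mono λ v q → ∖⁅⁆⁺ {S = N} q (λ { refl → absurd q p }))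
  ... | z , p with ∖⁅⁆⁻ p
  ... | q , z≢x with F-neighbours⁻ q
  ... | f , Ff , j′ = f , z , Ff , j′ , λ { refl → z≢x (proj₂ (F-same Ff Ky Ky j j′)) }

  third-edge : K y ≡ true → F e ≡ true → Joins G e y x → F f ≡ true → Joins G f y z → f ≢ e →
    F g ≡ true → Joins G g y u → g ≢ e → u ≡ z
  third-edge {f = f} {g = g} Ky Fe j Ff j′ f≢e Fg j″ g≢e with g ≟ f
  ... | yes refl = proj₂ (F-same Fg Ky Ky j′ j″)
  ... | no g≢f = ⊥-elim (≤2-edges Ky Fe Ff Fg (f≢e ∘ sym) g≢e g≢f j j′ j″)

  -- P collects the type-1 vertices met by the walk; each of them adds at most one new neighbour to Q, and reaching y
  -- through its second edge makes (P ∪ {y}, Q) tight.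
  F-no-return : F e ≡ true → K y ≡ true → Joins G e y x → Walk G F x y es → All (e ≢_) es → ⊥
  F-no-return {e} {y} {x} Fe Ky jₑ = go (λ _ → false) ⁅ x ⁆ (λ _ ()) refl (λ _ _ _ _ _ ())
    (≤-trans (≤-reflexive (card-⁅⁆ x)) (s≤s z≤n)) ⁅⁆-self
    (λ p → absurd p (true⇒false {col} (F⊆H e Fe) jₑ (K⊆ _ Ky))) (λ _ → ⁅⁆-self)
    where
    -- The current vertex `c` lies in `P` or in `Q` according to its type. At the start `P` is empty
    -- and `Q` is `⁅ x ⁆`, whence the `suc` in the size bound.
    go : ∀ {c es} (P Q : VSet) → P ⊆ K → P y ≡ false → Covers F P Q → card Q ≤ suc (card P) → Q x ≡ true →
      (col c ≡ true → P c ≡ true) → (col c ≡ false → Q c ≡ true) →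
      Walk G F c y es → All (e ≢_) es → ⊥
    go P Q P⊆ y∉P cov le x∈Q at₁ at₀ nil [] = absurd (at₁ (K⊆ _ Ky)) y∉P
    go {c} P Q P⊆ y∉P cov le x∈Q at₁ at₀ (cons {v = d} f Ff j walk) (e≢f ∷ avoid) with true? (col c)
    ... | inj₁ c₁ = go P Q P⊆ y∉P cov le x∈Q
      (λ p → absurd p (true⇒false {col} (F⊆H f Ff) j c₁)) (λ _ → cov f c d Ff j (at₁ c₁)) walk avoid
    ... | inj₂ c₀ with true? (P d)
    ... | inj₁ d∈P = go P Q P⊆ y∉P cov le x∈Q (λ _ → d∈P)
      (λ p → absurd (false⇒true {col} (F⊆H f Ff) j c₀) p) walk avoid
    ... | inj₂ d∉P with touching⁻ (F⊆touching f Ff) j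
    ... | inj₁ Kc = absurd (K⊆ _ Kc) c₀
    ... | inj₂ Kd with d ≟ y
    -- The walk re-enters `y` from `c` by an edge other than `e`. By `≤2-edges` these are its only
    -- edges in `F`, and their other ends `x` and `c` are both in `Q`.
    ... | yes refl = F-hall (P ∪ ⁅ y ⁆ , Q , (y , ∪⁺ʳ ⁅⁆-self) , ∪-⊆ P⊆ sub , cov′ ,
      ≤-trans le (card-insert-> {S = P} d∉P))
      where
      sub : ⁅ y ⁆ ⊆ K
      sub v p with ⁅⁆⁻ p
      ... | refl = Ky
      cov′ : Covers F (P ∪ ⁅ y ⁆) Q
      cov′ g s z Fg j′ p with ∪⁻ p
      ... | inj₁ q = cov g s z Fg j′ q
      ... | inj₂ q with ⁅⁆⁻ q
      ... | refl with g ≟ e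
      ... | yes refl = subst (λ v → Q v ≡ true) (sym (proj₂ (F-same Fg Ky Ky jₑ j′))) x∈Q
      ... | no g≢e = subst (λ v → Q v ≡ true)
        (sym (third-edge Ky Fe jₑ Ff (swap j) (e≢f ∘ sym) Fg j′ g≢e)) (at₀ c₀)
    -- The vertex `d` is entered from `c`, already in `Q`, so its one other edge adds at most `x′`
    -- to `Q` while `P` gains `d`.
    ... | no d≢y with other-edge Kd Ff (swap j)
    ... | f′ , x′ , Ff′ , j′ , f′≢f = go (P ∪ ⁅ d ⁆) (Q ∪ ⁅ x′ ⁆) (∪-⊆ P⊆ sub) y∉ cov′
      (≤-trans (card-insert-≤ Q x′) (s≤s (≤-trans le (card-insert-> {S = P} d∉P))))
      (∪⁺ˡ x∈Q) (λ _ → ∪⁺ʳ ⁅⁆-self) (λ p → absurd (false⇒true {col} (F⊆H f Ff) j c₀) p) walk avoid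
      where
      sub : ⁅ d ⁆ ⊆ K
      sub v p with ⁅⁆⁻ p
      ... | refl = Kd
      y∉ : (P ∪ ⁅ d ⁆) y ≡ false
      y∉ with true? ((P ∪ ⁅ d ⁆) y)
      ... | inj₂ p = p
      ... | inj₁ p with ∪⁻ p
      ... | inj₁ q = absurd q y∉P
      ... | inj₂ q = ⊥-elim (d≢y (sym (⁅⁆⁻ q)))
      cov′ : Covers F (P ∪ ⁅ d ⁆) (Q ∪ ⁅ x′ ⁆)
      cov′ g s z Fg j″ p with ∪⁻ p
      ... | inj₁ q = ∪⁺ˡ (cov g s z Fg j″ q)
      ... | inj₂ q with ⁅⁆⁻ q
      ... | refl with g ≟ f
      ... | yes refl = ∪⁺ˡ (subst (λ v → Q v ≡ true) (sym (proj₂ (F-same Fg Kd Kd (swap j) j″))) (at₀ c₀))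
      ... | no g≢f = ∪⁺ʳ (subst (λ v → ⁅ x′ ⁆ v ≡ true)
        (sym (third-edge Kd Ff (swap j) Ff′ j′ f′≢f Fg j″ g≢f)) ⁅⁆-self)

  -- Completing the forest to a spanning tree.

  opaque
    -- Minimal among the connected edge sets between `F` and `H`, so that the edges outside `F`
    -- become bridges.
    minimalConn : ∃[ T ] ((Conn T × F ⊆ T) × T ⊆ H ×
      (∀ e → T e ≡ true → ¬ (Conn (T ∖ ⁅ e ⁆) × F ⊆ (T ∖ ⁅ e ⁆))))
    minimalConn = minimalSet {P = λ E → Conn E × F ⊆ E}
      (λ E → conn? E ×-dec all? (λ e → (F e ≟ᵇ true) →-dec (E e ≟ᵇ true))) H (conn , F⊆H)

  T : ESet
  T = proj₁ minimalConn

  T-conn : Conn T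
  T-conn = proj₁ (proj₁ (proj₂ minimalConn))

  F⊆T : F ⊆ T
  F⊆T = proj₂ (proj₁ (proj₂ minimalConn))

  T⊆H : T ⊆ H
  T⊆H = proj₁ (proj₂ (proj₂ minimalConn))

  T-minimal : ∀ e → T e ≡ true → ¬ (Conn (T ∖ ⁅ e ⁆) × F ⊆ (T ∖ ⁅ e ⁆))
  T-minimal = proj₂ (proj₂ (proj₂ minimalConn))

  -- If the ends of `g` were joined by a walk avoiding `g`, that walk would cross every cut that `g`
  -- crosses, and `g` could be deleted.
  T-bridge : T g ≡ true → F g ≡ false → Joins G g c d → Walk G T d c es → All (g ≢_) es → ⊥
  T-bridge {g} {c} {d} Tg F̸g j walk avoid = T-minimal g Tg (conn′ , λ e h → ∖⁅⁆⁺ (F⊆T e h) (λ { refl → absurd h F̸g }))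
    where
    back : ∀ {U a b es} → Walk G T a b es → All (g ≢_) es → U a ≡ true → U b ≡ false →
      Cross (InE (T ∖ ⁅ g ⁆)) U
    back walk avoid p q with walk-cross walk p q
    ... | e , a , b , j , (l , h) , s , t = e , a , b , j , ∖⁅⁆⁺ h (≢-sym (All.lookup avoid l)) , s , t
    conn′ : Conn (T ∖ ⁅ g ⁆)
    conn′ U p q with T-conn U p q
    ... | e , a , b , j′ , h , s , t with e ≟ g
    ... | no e≢g = e , a , b , j′ , ∖⁅⁆⁺ h e≢g , s , t
    ... | yes refl with Joins-unique j j′
    ... | inj₂ (refl , refl) = back walk avoid s t
    ... | inj₁ (refl , refl) with reverseʷ walk avoid
    ... | es′ , walk′ , avoid′ = back walk′ avoid′ s t

  -- The trail is split at its first edge outside `F`; as its edges are distinct, neither remaining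
  -- piece uses that edge.
  F-walk-or-exit : Walk G T u v es → Unique es → Walk G F u v es ⊎
    ∃[ g ] ∃[ c ] ∃[ d ] ((g ∈ˡ es × T g ≡ true × F g ≡ false × Joins G g c d) ×
      (∃[ fs ] (Walk G T u c fs × All (g ≢_) fs)) × (∃[ fs ] (Walk G T d v fs × All (g ≢_) fs)))
  F-walk-or-exit nil [] = inj₁ nil
  F-walk-or-exit (cons e h j walk) (e∉ ∷ uniq) with true? (F e)
  ... | inj₂ p = inj₂ (e , _ , _ , (here refl , h , p , j) , (_ , nil , []) , (_ , walk , e∉))
  ... | inj₁ p with F-walk-or-exit walk uniq
  ... | inj₁ walk′ = inj₁ (cons e p j walk′)
  ... | inj₂ (g , c , d , (l , rest) , (fs , pre , avoid) , post) =
    inj₂ (g , c , d , (there l , rest) , (e ∷ fs , cons e h j pre , ≢-sym (All.lookup e∉ l) ∷ avoid) , post)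

  -- A closed trail with an edge outside `F` contradicts `T-bridge`. Otherwise its first edge has an
  -- end in `K`, and `F-no-return` applies to the rest of the trail, reversed if that end is the
  -- second one.
  T-acyclic : Acyclic G T
  T-acyclic u es walk uniq with F-walk-or-exit walk uniq
  ... | inj₂ (g , c , d , (_ , Tg , F̸g , j) , (_ , pre , av) , (_ , post , av′)) =
    ⊥-elim (T-bridge Tg F̸g j (post ++ʷ pre) (++⁺ av′ av))
  T-acyclic u [] walk uniq | inj₁ nil = refl
  T-acyclic u (e ∷ es) walk (e∉ ∷ _) | inj₁ (cons e Fe j walk′) with touching⁻ (F⊆touching e Fe) j
  ... | inj₁ Ku = ⊥-elim (F-no-return Fe Ku j walk′ e∉)
  ... | inj₂ Kv with reverseʷ walk′ e∉
  ... | es′ , back , avoid = ⊥-elim (F-no-return Fe Kv (swap j) back avoid)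

  2≤degIn : ∀ y → K y ≡ true → 2 ≤ degIn G T y
  2≤degIn y Ky with F-neighbours⁻ (proj₂ (card⇒member (F-neighbours y) (≤-trans (s≤s z≤n) (≥2-neighbours Ky))))
  ... | e , Fe , j with other-edge Ky Fe j
  ... | f , z , Ff , j′ , f≢e = ≤-trans (≤-trans (s≤s (member⇒card {S = ⁅ f ⁆} ⁅⁆-self))
      (card-insert-> {S = ⁅ f ⁆} (⁅⁆-≢ (≢-sym f≢e))))
    (≤-trans (card-mono sub) (≤-reflexive (sym (degIn-card T y))))
    where
    at : ∀ {e x} → F e ≡ true → Joins G e y x → (T e ∧ incident G y e) ≡ true
    at {e} h j rewrite F⊆T e h = incident⁺ j
    sub : (⁅ f ⁆ ∪ ⁅ e ⁆) ⊆ (λ e → T e ∧ incident G y e)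
    sub g p with ∪⁻ p
    ... | inj₁ q with ⁅⁆⁻ q
    ... | refl = at Ff j′
    sub g p | inj₂ q with ⁅⁆⁻ q
    ... | refl = at Fe j

  opaque
    hallTree : ∃[ T ] (SpanningTree G T × ProperOn G T col × (∀ y → K y ≡ true → 2 ≤ degIn G T y))
    hallTree = T , (Conn⇒Connected T-conn , T-acyclic) ,
      (λ e h → bichromatic⁻ {col} (Joins-ends e) (T⊆H e h)) , 2≤degIn

-- Connected bichromatic subgraphs and their extension.

module Colouring (G : Graph) (connected : IsConnected G) (irregular : ¬ RegularBipartite G) where
  open Cuts G
  open Tightness G

  private variable
    e f : Edge G
    p q u v w x y z : V
    col col′ A B S Q U : VSet

  G-conn : Conn (allEdges G)
  G-conn = Connected⇒Conn connected

  opaque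
    critical : VSet
    critical v = ⌊ deg G v ℕ.≟ Δ G ⌋

    critical⁻ : critical v ≡ true → deg G v ≡ Δ G
    critical⁻ {v} h with deg G v ℕ.≟ Δ G
    ... | yes p = p

    critical⁺ : deg G v ≡ Δ G → critical v ≡ true
    critical⁺ {v} h with deg G v ℕ.≟ Δ G
    ... | yes _ = refl
    ... | no ¬p = ⊥-elim (¬p h)

  K : VSet → VSet
  K col = col ∩ critical

  -- The form in which the hypothesis that `G` is not regular bipartite enters the search for a
  -- colouring: as a strict count.
  not-closed : ∃[ s ] S s ≡ true → S ⊆ critical → (∀ v → S v ≡ true → Q v ≡ true → ⊥) →
    (∀ e u v → Joins G e u v → S u ≡ true → Q v ≡ true) → card S < card Q
  not-closed {S} {Q} ne crit disj nbr = ≰⇒> λ le → irregular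
    (closed⇒regularBipartite G-conn S Q ne (λ v h → critical⁻ (crit v h)) disj nbr le)

  Within : VSet → VSet → Edge G → V → V → Set
  Within col A e p q = A p ≡ true × A q ≡ true × col p ≢ col q

  -- Cut form of connectedness for the bichromatic subgraph induced on `A`.
  ConnOn : VSet → VSet → Set
  ConnOn col A = ∀ U {a b} → A a ≡ true → U a ≡ true → A b ≡ true → U b ≡ false →
    Cross (Within col A) U

  Cross-mono : A ⊆ B → Cross (Within col A) U → Cross (Within col B) U
  Cross-mono sub (e , p , q , j , (a , b , ne) , s , t) = e , p , q , j , (sub p a , sub q b , ne) , s , t

  -- The common vertex is on one side of the cut, and the part that also reaches the other side
  -- supplies the crossing edge.
  ConnOn-∪ : ConnOn col A → ConnOn col B → A v ≡ true → B v ≡ true → ConnOn col (A ∪ B)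
  ConnOn-∪ {col} {A} {B} {c} cA cB c∈A c∈B U a∈ Ua b∈ Ub with true? (U c)
  ... | inj₁ Uc with ∪⁻ b∈
  ... | inj₁ h = Cross-mono {A} {A ∪ B} {col} {U} (λ _ → ∪⁺ˡ) (cA U c∈A Uc h Ub)
  ... | inj₂ h = Cross-mono {B} {A ∪ B} {col} {U} (λ _ → ∪⁺ʳ) (cB U c∈B Uc h Ub)
  ConnOn-∪ {col} {A} {B} {c} cA cB c∈A c∈B U a∈ Ua b∈ Ub | inj₂ Uc with ∪⁻ a∈
  ... | inj₁ h = Cross-mono {A} {A ∪ B} {col} {U} (λ _ → ∪⁺ˡ) (cA U h Ua c∈A Uc)
  ... | inj₂ h = Cross-mono {B} {A ∪ B} {col} {U} (λ _ → ∪⁺ʳ) (cB U h Ua c∈B Uc)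

  Agree : VSet → VSet → VSet → Set
  Agree A col′ col = ∀ v → A v ≡ true → col′ v ≡ col v

  ConnOn-agree : Agree A col′ col → ConnOn col A → ConnOn col′ A
  ConnOn-agree agree c U a Ua b Ub with c U a Ua b Ub
  ... | e , p , q , j , (a′ , b′ , ne) , s , t = e , p , q , j ,
    (a′ , b′ , λ eq → ne (trans (sym (agree p a′)) (trans eq (agree q b′)))) , s , t

  ConnOn-⁅⁆ : ConnOn col ⁅ v ⁆
  ConnOn-⁅⁆ U a Ua b Ub with ⁅⁆⁻ a | ⁅⁆⁻ b
  ... | refl | refl = absurd Ua Ub

  ConnOn-edge : Joins G e p q → col p ≢ col q → ConnOn col (⁅ p ⁆ ∪ ⁅ q ⁆)
  ConnOn-edge {p = p} {q = q} j ne U a Ua b Ub with ∪⁻ a | ∪⁻ b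
  ... | inj₁ h | inj₁ g rewrite ⁅⁆⁻ h | ⁅⁆⁻ g = absurd Ua Ub
  ... | inj₂ h | inj₂ g rewrite ⁅⁆⁻ h | ⁅⁆⁻ g = absurd Ua Ub
  ... | inj₁ h | inj₂ g rewrite ⁅⁆⁻ h | ⁅⁆⁻ g = _ , p , q , j , (∪⁺ˡ ⁅⁆-self , ∪⁺ʳ ⁅⁆-self , ne) , Ua , Ub
  ... | inj₂ h | inj₁ g rewrite ⁅⁆⁻ h | ⁅⁆⁻ g = _ , q , p , swap j , (∪⁺ʳ ⁅⁆-self , ∪⁺ˡ ⁅⁆-self , ne ∘ sym) , Ua , Ub

  ∉⇒≢ : A p ≡ true → A q ≡ false → p ≢ q
  ∉⇒≢ h g refl = absurd h g

  agree-update : ∀ {b} → A q ≡ false → Agree A (col [ q ↦ b ]) col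
  agree-update {A = A} h v g = update-other (∉⇒≢ {A = A} g h)

  ConnOn-attach : ∀ {b} → ConnOn col A → A p ≡ true → A q ≡ false → Joins G e p q → b ≢ col p →
    ConnOn (col [ q ↦ b ]) (A ∪ (⁅ p ⁆ ∪ ⁅ q ⁆))
  ConnOn-attach {col} {A} {p} {q} {b = b} c p∈A q∉A j ne = ConnOn-∪ {col [ q ↦ b ]} {A} {⁅ p ⁆ ∪ ⁅ q ⁆}
    (ConnOn-agree {A} {col [ q ↦ b ]} {col} (agree-update {A} {q} {col} q∉A) c)
    (ConnOn-edge {col = col [ q ↦ b ]} j ne′) p∈A (∪⁺ˡ ⁅⁆-self)
    where
    ne′ : (col [ q ↦ b ]) p ≢ (col [ q ↦ b ]) q
    ne′ eq = ne (sym (trans (sym (agree-update {A} {q} {col} q∉A p p∈A)) (trans eq update-same)))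

  opaque
    -- Some edge of `G` leaves `A` as long as `A` is not everything; giving its outer end the type
    -- opposite to its inner end makes the edge bichromatic and enlarges `A`.
    extend : ∀ col A → A v ≡ true → ConnOn col A → ∃[ col′ ] (Agree A col′ col × Conn (bichromatic col′))
    extend {v} col A = go (n G) col A (m≤n+m _ _)
      where
      go : ∀ k col A → n G ≤ card A + k → A v ≡ true → ConnOn col A →
        ∃[ col′ ] (Agree A col′ col × Conn (bichromatic col′))
      go k col A le v∈A c with any? (λ u → A u ≟ᵇ false)
      ... | no ¬p = col , (λ _ _ → refl) , λ U a b → to-conn (c U (full _) a (full _) b)
        where
        full : ∀ u → A u ≡ true
        full u with true? (A u)
        ... | inj₁ h = h
        ... | inj₂ h = ⊥-elim (¬p (u , h))
        to-conn : Cross (Within col A) U → Cross (InE (bichromatic col)) U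
        to-conn (e , p , q , j , (_ , _ , ne) , s , t) = e , p , q , j , bichromatic⁺ {col} j ne , s , t
      ... | yes (u , u∉A) with G-conn A v∈A u∉A
      go zero col A le v∈A c | yes _ | e , p , q , j , _ , p∈A , q∉A =
        ⊥-elim (<-irrefl refl (≤-trans (s≤s (≤-trans le (≤-reflexive (+-identityʳ _))))
          (≤-trans (card-insert-> {S = A} {y = q} q∉A) (card≤ _))))
      go (suc k) col A le v∈A c | yes _ | e , p , q , j , _ , p∈A , q∉A
        with go k (col [ q ↦ not (col p) ]) (A ∪ (⁅ p ⁆ ∪ ⁅ q ⁆))
          (≤-trans le (≤-trans (≤-reflexive (+-suc _ k)) (+-monoˡ-≤ k
            (card-< {S = A} {y = q} (λ _ → ∪⁺ˡ) (∪⁺ʳ (∪⁺ʳ ⁅⁆-self)) q∉A))))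
          (∪⁺ˡ v∈A) (ConnOn-attach {col} {A} c p∈A q∉A j (not-¬ refl ∘ sym))
      ... | col′ , agree , c′ = col′ ,
        (λ u h → trans (agree u (∪⁺ˡ h)) (agree-update {A} {q} {col} q∉A u h)) , c′

  -- Structure of a minimal tight pair.

  module MinimalPair {col S Q : VSet} (minimal : MinimalTight (bichromatic col) (K col) S Q) where

    S-nonempty : ∃[ s ] S s ≡ true
    S-nonempty = proj₁ (proj₁ minimal)

    S⊆K : S ⊆ K col
    S⊆K = proj₁ (proj₂ (proj₁ minimal))

    covers : Covers (bichromatic col) S Q
    covers = proj₁ (proj₂ (proj₂ (proj₁ minimal)))

    Q≤S : card Q ≤ card S
    Q≤S = proj₂ (proj₂ (proj₂ (proj₁ minimal)))

    S-true : ∀ {s} → S s ≡ true → col s ≡ true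
    S-true h = proj₁ (∩⁻ (S⊆K _ h))

    smaller-strict : ∀ {S′ Q′} → S′ ⊆ S → ∃[ s ] S′ s ≡ true → Covers (bichromatic col) S′ Q′ →
      card S′ + card Q′ < card S + card Q → card S′ < card Q′
    smaller-strict sub ne cov lt = ≰⇒> λ le →
      <⇒≱ lt (proj₂ minimal _ _ (ne , (λ v h → S⊆K v (sub v h)) , cov , le))

    -- A vertex of `Q` without a neighbour in `S` could be dropped, leaving a smaller tight pair.
    Q-neighbour : Q q ≡ true → ∃[ e ] ∃[ s ] (S s ≡ true × bichromatic col e ≡ true × Joins G e s q)
    Q-neighbour {q} q∈Q with any? (λ e → any? λ s →
      (S s ≟ᵇ true) ×-dec (bichromatic col e ≟ᵇ true) ×-dec Joins? e s q)
    ... | yes p = p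
    ... | no ¬p = ⊥-elim (<⇒≱ (≤-trans (smaller-strict (λ _ → id) S-nonempty cov
        (+-monoʳ-< (card S) less)) (<⇒≤ less)) Q≤S)
      where
      less : card (Q ∖ ⁅ q ⁆) < card Q
      less = ≤-reflexive (sym (card-remove {S = Q} q∈Q))
      cov : Covers (bichromatic col) S (Q ∖ ⁅ q ⁆)
      cov e y x i j h = ∖⁅⁆⁺ (covers e y x i j h) (λ { refl → ¬p (e , y , h , i , j) })

    Q-false : Q q ≡ true → col q ≡ false
    Q-false h with Q-neighbour h
    ... | e , s , s∈S , i , j = true⇒false {col} i j (S-true s∈S)

    split< : S y ≡ true → U y ≡ false → card (S ∩ U) + card (Q ∩ U) < card S + card Q
    split< {y} {U} y∈S y∉U = +-mono-<-≤
      (card-< {Q = S} {y = y} (λ _ h → proj₁ (∩⁻ h)) y∈S (≢true⇒false (λ h → absurd (proj₂ (∩⁻ {Q = U} h)) y∉U)))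
      (card-mono λ _ h → proj₁ (∩⁻ h))

    split<′ : S y ≡ true → U y ≡ true → card (S ∖ U) + card (Q ∖ U) < card S + card Q
    split<′ {y} {U} y∈S y∈U = +-mono-<-≤
      (card-< {Q = S} {y = y} (λ _ h → proj₁ (∖⁻ h)) y∈S (≢true⇒false (λ h → absurd y∈U (proj₂ (∖⁻ {Q = U} h)))))
      (card-mono λ _ h → proj₁ (∖⁻ h))

    -- Without a crossing edge, `U` would split the pair into two smaller covers. Each expands
    -- strictly by minimality, and adding them gives |S| < |Q|.
    ConnOn-pair : ConnOn col (S ∪ Q)
    ConnOn-pair U {a} {b} a∈ Ua b∈ Ub with cross? {R = Within col (S ∪ Q)}
        (λ e p q → ((S ∪ Q) p ≟ᵇ true) ×-dec ((S ∪ Q) q ≟ᵇ true) ×-dec ¬? (col p ≟ᵇ col q)) U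
    ... | yes c = c
    ... | no ¬c = ⊥-elim (<-irrefl refl (begin-strict
        card S                        ≡⟨ sym (card-split S U) ⟩
        card (S ∩ U) + card (S ∖ U)   <⟨ +-mono-<-≤ in-strict (<⇒≤ out-strict) ⟩
        card (Q ∩ U) + card (Q ∖ U)   ≡⟨ card-split Q U ⟩
        card Q                        ≤⟨ Q≤S ⟩
        card S                        ∎))
      where
      open ≤-Reasoning
      -- A side that meets only `Q` at first also meets `S`, through a neighbour supplied by
      -- `Q-neighbour`.
      S-in : ∃[ s ] (S s ≡ true × U s ≡ true)
      S-in with ∪⁻ a∈
      ... | inj₁ h = a , h , Ua
      ... | inj₂ h with Q-neighbour h
      ... | e , s , s∈S , i , j with true? (U s)
      ... | inj₁ Us = s , s∈S , Us
      ... | inj₂ Us = ⊥-elim (¬c (e , a , s , swap j ,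
        (a∈ , ∪⁺ˡ s∈S , bichromatic⁻ {col} (swap j) i) , Ua , Us))
      S-out : ∃[ s ] (S s ≡ true × U s ≡ false)
      S-out with ∪⁻ b∈
      ... | inj₁ h = b , h , Ub
      ... | inj₂ h with Q-neighbour h
      ... | e , s , s∈S , i , j with true? (U s)
      ... | inj₂ Us = s , s∈S , Us
      ... | inj₁ Us = ⊥-elim (¬c (e , s , b , j ,
        (∪⁺ˡ s∈S , b∈ , bichromatic⁻ {col} j i) , Us , Ub))
      in-strict : card (S ∩ U) < card (Q ∩ U)
      in-strict = smaller-strict (λ _ h → proj₁ (∩⁻ h))
        (proj₁ S-in , ∩⁺ (proj₁ (proj₂ S-in)) (proj₂ (proj₂ S-in))) cov
        (split< {U = U} (proj₁ (proj₂ S-out)) (proj₂ (proj₂ S-out)))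
        where
        cov : Covers (bichromatic col) (S ∩ U) (Q ∩ U)
        cov e y x i j h with ∩⁻ h
        ... | y∈S , Uy with true? (U x)
        ... | inj₁ Ux = ∩⁺ (covers e y x i j y∈S) Ux
        ... | inj₂ Ux = ⊥-elim (¬c (e , y , x , j ,
          (∪⁺ˡ y∈S , ∪⁺ʳ (covers e y x i j y∈S) , bichromatic⁻ {col} j i) , Uy , Ux))
      out-strict : card (S ∖ U) < card (Q ∖ U)
      out-strict = smaller-strict (λ _ h → proj₁ (∖⁻ h))
        (proj₁ S-out , ∖⁺ (proj₁ (proj₂ S-out)) (proj₂ (proj₂ S-out))) cov
        (split<′ {U = U} (proj₁ (proj₂ S-in)) (proj₂ (proj₂ S-in)))
        where
        cov : Covers (bichromatic col) (S ∖ U) (Q ∖ U)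
        cov e y x i j h with ∖⁻ h
        ... | y∈S , Uy with true? (U x)
        ... | inj₂ Ux = ∖⁺ (covers e y x i j y∈S) Ux
        ... | inj₁ Ux = ⊥-elim (¬c (e , x , y , swap j ,
          (∪⁺ʳ (covers e y x i j y∈S) , ∪⁺ˡ y∈S , bichromatic⁻ {col} (swap j) i) , Ux , Uy))

    Avoids : V → Edge G → V → V → Set
    Avoids y e p q = p ≢ y × q ≢ y × col p ≢ col q

    -- If `U` separated the graph without `y`, the set `S` minus `y` would fall into two pieces
    -- covered by disjoint parts of `Q`. Each piece is at least one smaller than its part, so |S| -
    -- 1 + 2 ≤ |Q|, against tightness.
    not-cutvertex : Conn (bichromatic col) → S y ≡ true → ∀ U {a b} → a ≢ y → U a ≡ true →
      b ≢ y → U b ≡ false → Cross (Avoids y) U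
    not-cutvertex {y} conn y∈S U {a} {b} a≢y Ua b≢y Ub with cross? {R = Avoids y}
        (λ e p q → ¬? (p ≟ y) ×-dec ¬? (q ≟ y) ×-dec ¬? (col p ≟ᵇ col q)) U
    ... | yes c = c
    ... | no ¬c = ⊥-elim (<-irrefl refl (begin-strict
        card S                              ≡⟨ card-remove {S = S} y∈S ⟩
        suc (card S⁻)                       ≡⟨ cong suc (sym (card-split S⁻ U)) ⟩
        suc (card (S⁻ ∩ U) + card (S⁻ ∖ U)) <⟨ +-mono-≤-< in-strict out-strict ⟩
        card (Q ∩ U) + card (Q ∖ U)         ≡⟨ card-split Q U ⟩
        card Q                              ≤⟨ Q≤S ⟩
        card S                              ∎))
      where
      open ≤-Reasoning
      S⁻ = S ∖ ⁅ y ⁆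
      S⁻<S : card S⁻ < card S
      S⁻<S = ≤-reflexive (sym (card-remove {S = S} y∈S))
      -- The connected graph must leave this side through `y`, which puts a neighbour of `y`, hence
      -- a vertex of `Q`, there.
      Q-in : ∃[ x ] (Q x ≡ true × U x ≡ true)
      Q-in with conn (U ∖ ⁅ y ⁆) (∖⁅⁆⁺ Ua a≢y) (≢true⇒false (λ h → absurd (proj₁ (∖⁻ h)) Ub))
      ... | e , p , q , j , i , p∈ , q∉ with ∖⁅⁆⁻ p∈ | q ≟ y
      ... | Up , p≢y | yes refl = p , covers e y p i (swap j) y∈S , Up
      ... | Up , p≢y | no q≢y = ⊥-elim (¬c (e , p , q , j , (p≢y , q≢y , bichromatic⁻ {col} j i) ,
        Up , ≢true⇒false (λ h → absurd (∖⁅⁆⁺ h q≢y) q∉)))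
      Q-out : ∃[ x ] (Q x ≡ true × U x ≡ false)
      Q-out with conn (U ∪ ⁅ y ⁆) (∪⁺ˡ Ua) (≢true⇒false not-b)
        where
        not-b : (U ∪ ⁅ y ⁆) b ≢ true
        not-b h with ∪⁻ h
        ... | inj₁ r = absurd r Ub
        ... | inj₂ r = b≢y (⁅⁆⁻ r)
      ... | e , p , q , j , i , p∈ , q∉ with p ≟ y
      ... | yes refl = q , covers e y q i j y∈S , ≢true⇒false (λ h → absurd (∪⁺ˡ h) q∉)
      ... | no p≢y with ∪⁻ p∈
      ... | inj₂ r = ⊥-elim (p≢y (⁅⁆⁻ r))
      ... | inj₁ Up = ⊥-elim (¬c (e , p , q , j ,
        (p≢y , (λ { refl → absurd (∪⁺ʳ ⁅⁆-self) q∉ }) , bichromatic⁻ {col} j i) ,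
        Up , ≢true⇒false (λ h → absurd (∪⁺ˡ h) q∉)))
      -- A piece of `S` may be empty; the strict inequality then comes from the nonempty part of
      -- `Q`.
      piece-strict : ∀ {S′ Q′} → S′ ⊆ S⁻ → Q′ ⊆ Q → (∃[ x ] Q′ x ≡ true) → Covers (bichromatic col) S′ Q′ →
        card S′ < card Q′
      piece-strict {S′} {Q′} subS subQ (x , x∈) cov = ≰⇒> λ le → <⇒≱
        (smaller-strict (λ v h → proj₁ (∖⁅⁆⁻ (subS v h)))
          (card⇒member S′ (≤-trans (member⇒card {S = Q′} x∈) le)) cov
          (+-mono-<-≤ (≤-trans (s≤s (card-mono subS)) S⁻<S) (card-mono subQ))) le
      Q≢y : Q x ≡ true → x ≢ y
      Q≢y h refl = absurd (S-true y∈S) (Q-false h)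
      in-strict : card (S⁻ ∩ U) < card (Q ∩ U)
      in-strict = piece-strict (λ _ h → proj₁ (∩⁻ h)) (λ _ h → proj₁ (∩⁻ h))
        (proj₁ Q-in , ∩⁺ (proj₁ (proj₂ Q-in)) (proj₂ (proj₂ Q-in))) cov
        where
        cov : Covers (bichromatic col) (S⁻ ∩ U) (Q ∩ U)
        cov e s x i j h with ∩⁻ h
        ... | s∈ , Us with ∖⁅⁆⁻ s∈ | true? (U x)
        ... | s∈S , s≢y | inj₁ Ux = ∩⁺ (covers e s x i j s∈S) Ux
        ... | s∈S , s≢y | inj₂ Ux = ⊥-elim (¬c (e , s , x , j ,
          (s≢y , Q≢y (covers e s x i j s∈S) , bichromatic⁻ {col} j i) , Us , Ux))
      out-strict : card (S⁻ ∖ U) < card (Q ∖ U)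
      out-strict = piece-strict (λ _ h → proj₁ (∖⁻ h)) (λ _ h → proj₁ (∖⁻ h))
        (proj₁ Q-out , ∖⁺ (proj₁ (proj₂ Q-out)) (proj₂ (proj₂ Q-out))) cov
        where
        cov : Covers (bichromatic col) (S⁻ ∖ U) (Q ∖ U)
        cov e s x i j h with ∖⁻ h
        ... | s∈ , Us with ∖⁅⁆⁻ s∈ | true? (U x)
        ... | s∈S , s≢y | inj₂ Ux = ∖⁺ (covers e s x i j s∈S) Ux
        ... | s∈S , s≢y | inj₁ Ux = ⊥-elim (¬c (e , x , s , swap j ,
          (Q≢y (covers e s x i j s∈S) , s≢y , bichromatic⁻ {col} (swap j) i) , Ux , Us))

    flipped-edge : Joins G f y z → col z ≡ true → bichromatic (col [ y ↦ false ]) f ≡ true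
    flipped-edge {y = y} j z₁ = bichromatic⁺ {col [ y ↦ false ]} j λ eq → absurd
      (trans (update-other (≢-sym (Joins-≢ j))) z₁) (trans (sym eq) update-same)

    unflipped : Cross (Avoids y) U → Cross (InE (bichromatic (col [ y ↦ false ]))) U
    unflipped {y} (e , p , q , j , (p≢y , q≢y , ne) , s , t) = e , p , q , j ,
      bichromatic⁺ {col [ y ↦ false ]} j
        (λ eq → ne (trans (sym (update-other p≢y)) (trans eq (update-other q≢y)))) , s , t

    -- The other vertices stay connected by `not-cutvertex`, and `y`, once of type 0, hangs on its
    -- type-1 neighbour `z`.
    flip-conn : Conn (bichromatic col) → S y ≡ true → Joins G f y z → col z ≡ true →
      Conn (bichromatic (col [ y ↦ false ]))
    flip-conn {y} {f} {z} conn y∈S jf z₁ U {a} {b} Ua Ub with true? (U y) | true? (U z)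
    ... | inj₁ Uy | inj₂ Uz = f , y , z , jf , flipped-edge jf z₁ , Uy , Uz
    ... | inj₂ Uy | inj₁ Uz = f , z , y , swap jf , flipped-edge jf z₁ , Uz , Uy
    ... | inj₁ Uy | inj₁ Uz = unflipped {y} {U}
      (not-cutvertex conn y∈S U (≢-sym (Joins-≢ jf)) Uz (λ { refl → absurd Uy Ub }) Ub)
    ... | inj₂ Uy | inj₂ Uz = unflipped {y} {U}
      (not-cutvertex conn y∈S U (λ { refl → absurd Ua Uy }) Ua (≢-sym (Joins-≢ jf)) Uz)

  -- The root `w` is exempt because its type is prescribed and it is never flipped.
  ClosedAt : V → VSet → VSet → Set
  ClosedAt w S Q = ∀ e u v → Joins G e u v → u ≢ w → S u ≡ true → Q v ≡ true

  -- Flipping vertices and growing a core around the root.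

  module _ (w : V) where

    FlipStable : (VSet → Set) → Set
    FlipStable P = ∀ {col e y z} → P col → col y ≡ true → y ≢ w → Joins G e y z → col z ≡ true →
      P (col [ y ↦ false ])

    FlipOutcome : (VSet → Set) → Set
    FlipOutcome P = ∃[ col ] (Conn (bichromatic col) × P col × (¬ HasTight (bichromatic col) (K col) ⊎
      ∃[ S ] ∃[ Q ] (MinimalTight (bichromatic col) (K col) S Q × S w ≡ true × ClosedAt w S Q)))

    opaque
      -- Each flip removes a type-1 vertex, so the search stops. When no flip applies, every edge
      -- from a vertex of `S` other than `w` is bichromatic and thus ends in `Q`.
      flip-search : (P : VSet → Set) → FlipStable P → ∀ col → Conn (bichromatic col) → P col → FlipOutcome P
      flip-search P stable col = go (suc (card col)) col ≤-refl
        where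
        -- The bound is strict, so the case of zero fuel is vacuous.
        go : ∀ k col → card col < k → Conn (bichromatic col) → P col → FlipOutcome P
        go (suc k) col lt conn inv with hasTight? (bichromatic col) (K col)
        ... | no ¬t = col , conn , inv , inj₁ ¬t
        ... | yes t with minimalTight t
        ... | S , Q , minimal with any? (λ e → any? λ y → any? λ z →
            (S y ≟ᵇ true) ×-dec ¬? (y ≟ w) ×-dec Joins? e y z ×-dec (col z ≟ᵇ true))
        ... | yes (e , y , z , y∈S , y≢w , j , z₁) = go k (col [ y ↦ false ])
          (≤-trans (card-< {S = col [ y ↦ false ]} {y = y} sub (S-true y∈S) update-same) (s≤s⁻¹ lt))
          (flip-conn conn y∈S j z₁) (stable inv (S-true y∈S) y≢w j z₁)
          where
          open MinimalPair minimal
          sub : (col [ y ↦ false ]) ⊆ col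
          sub v h with v ≟ y
          ... | yes refl = absurd h update-same
          ... | no v≢y = trans (sym (update-other v≢y)) h
        ... | no ¬f = col , conn , inv , inj₂ (S , Q , minimal , w∈S , closed)
          where
          open MinimalPair minimal
          closed : ClosedAt w S Q
          closed e u v j u≢w u∈S = covers e u v (bichromatic⁺ {col} j λ eq →
            ¬f (e , u , v , u∈S , u≢w , j , trans (sym eq) (S-true u∈S))) j u∈S
          -- If `w` were outside `S`, the exemption in `ClosedAt` would be void and `not-closed`
          -- would contradict tightness.
          w∈S : S w ≡ true
          w∈S with true? (S w)
          ... | inj₁ h = h
          ... | inj₂ h = ⊥-elim (<⇒≱ (not-closed {S} {Q} S-nonempty (λ v p → proj₂ (∩⁻ (S⊆K v p)))
            (λ v p q → absurd (S-true p) (Q-false q))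
            (λ e u v j p → closed e u v j (λ { refl → absurd p h }) p)) Q≤S)

    -- A tight pair in `G` itself, except that `w` may have neighbours outside `X`. No colouring
    -- occurs in it, so it survives recolouring; `root-edge` serves to make overlaps with new pairs
    -- nonempty.
    record Core (X Y : VSet) : Set where
      field
        root      : Y w ≡ true
        Y⊆critical : Y ⊆ critical
        disjoint  : ∀ v → X v ≡ true → Y v ≡ true → ⊥
        closed    : ClosedAt w Y X
        size      : card X ≤ card Y
        root-edge : ∃[ e ] ∃[ x ] (Joins G e w x × X x ≡ true)

    record Compatible (X Y col : VSet) : Set where
      field
        X-false : ∀ v → X v ≡ true → col v ≡ false
        Y-true  : ∀ v → Y v ≡ true → col v ≡ true
        connOn  : ConnOn col (X ∪ Y)

    Compatible-agree : ∀ {X Y} → Agree (X ∪ Y) col′ col → Compatible X Y col → Compatible X Y col′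
    Compatible-agree {col′} {col} {X} {Y} agree c = record
      { X-false = λ v h → trans (agree v (∪⁺ˡ h)) (X-false v h)
      ; Y-true  = λ v h → trans (agree v (∪⁺ʳ h)) (Y-true v h)
      ; connOn  = ConnOn-agree {X ∪ Y} {col′} {col} agree connOn
      }
      where open Compatible c

    module _ {X Y : VSet} (core : Core X Y) where
      open Core core

      -- If all neighbours of `w` were in `X`, the core would contradict `not-closed`. A neighbour
      -- outside `X` is not in `Y` either, since closedness would then put `w` into `X`.
      core-exit : ∃[ e ] ∃[ z ] (Joins G e w z × (X ∪ Y) z ≡ false)
      core-exit with any? (λ e → any? λ z → Joins? e w z ×-dec (X z ≟ᵇ false))
      ... | yes (e , z , j , z∉X) = e , z , j , ≢true⇒false λ h → outside (∪⁻ h)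
        where
        outside : X z ≡ true ⊎ Y z ≡ true → ⊥
        outside (inj₁ h) = absurd h z∉X
        outside (inj₂ h) = disjoint w (closed e z w (swap j) (≢-sym (Joins-≢ j)) h) root
      ... | no ¬p = ⊥-elim (<⇒≱ (not-closed {Y} {X} (w , root) Y⊆critical (λ v p q → disjoint v q p) nbr) size)
        where
        nbr : ∀ e u v → Joins G e u v → Y u ≡ true → X v ≡ true
        nbr e u v j h with u ≟ w
        ... | no u≢w = closed e u v j u≢w h
        ... | yes refl with true? (X v)
        ... | inj₁ p = p
        ... | inj₂ p = ⊥-elim (¬p (e , v , j , p))

      -- A flipped vertex has type 1 and a type-1 neighbour. Vertices of `X` and `z` fail the first
      -- condition; those of `Y` other than `w` fail the second, all their neighbours being in `X`.
      Compatible-stable : ∀ {z} → (X ∪ Y) z ≡ false → FlipStable (λ col → Compatible X Y col × col z ≡ false)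
      Compatible-stable {z} z∉ {col} {e} {y} {u} (c , z₀) y₁ y≢w j u₁ =
        Compatible-agree (λ v h → update-other (v≢y v (∪⁻ h))) c ,
        trans (update-other (λ { refl → absurd y₁ z₀ })) z₀
        where
        open Compatible c
        v≢y : ∀ v → X v ≡ true ⊎ Y v ≡ true → v ≢ y
        v≢y v (inj₁ h) refl = absurd y₁ (X-false v h)
        v≢y v (inj₂ h) refl = absurd u₁ (X-false u (closed e y u j y≢w h))

      module _ {col S Q} (compatible : Compatible X Y col)
        (minimal : MinimalTight (bichromatic col) (K col) S Q)
        (w∈S : S w ≡ true) (closedS : ClosedAt w S Q) where
        open Compatible compatible
        open MinimalPair minimal

        root⇒Q : Joins G e w x → col x ≡ false → Q x ≡ true
        root⇒Q {e} {x} j x₀ = covers e w x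
          (bichromatic⁺ {col} j (λ eq → absurd (trans (sym eq) (S-true w∈S)) x₀)) j w∈S

        -- Apart from `w`, the neighbours of `Y ∩ S` lie in `X ∩ Q`, so `not-closed` gains the one
        -- unit that pays for `w`.
        overlap-size : card (Y ∩ S) ≤ card (X ∩ Q)
        overlap-size = ≤-trans (≤-reflexive (card-remove {S = Y ∩ S} (∩⁺ root w∈S))) rest
          where
          R = (Y ∩ S) ∖ ⁅ w ⁆
          rest : suc (card R) ≤ card (X ∩ Q)
          rest with card R in eq
          ... | suc c = subst (_< card (X ∩ Q)) eq (not-closed {R} {X ∩ Q}
              (card⇒member R (subst (1 ≤_) (sym eq) (s≤s z≤n)))
              (λ v h → Y⊆critical v (proj₁ (∩⁻ (proj₁ (∖⁅⁆⁻ h)))))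
              (λ v p q → disjoint v (proj₁ (∩⁻ q)) (proj₁ (∩⁻ (proj₁ (∖⁅⁆⁻ p))))) nbr)
            where
            nbr : ∀ e u v → Joins G e u v → R u ≡ true → (X ∩ Q) v ≡ true
            nbr e u v j h with ∖⁅⁆⁻ h
            ... | h′ , u≢w = ∩⁺ (closed e u v j u≢w (proj₁ (∩⁻ h′))) (closedS e u v j u≢w (proj₂ (∩⁻ h′)))
          -- Only `w` is left: its neighbour in `X` has type 0 and hence lies in `Q`.
          ... | zero with root-edge
          ... | e , x , j , x∈X = member⇒card {S = X ∩ Q} (∩⁺ x∈X (root⇒Q j (X-false x x∈X)))

        grown-core : Core (X ∪ Q) (Y ∪ S)
        grown-core = record
          { root = ∪⁺ˡ root
          ; Y⊆critical = ∪-⊆ Y⊆critical (λ v h → proj₂ (∩⁻ (S⊆K v h)))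
          ; disjoint = λ v p q → absurd (Y∪S-true v q) (X∪Q-false v p)
          ; closed = closed′
          -- The sizes are uncrossed: the bound on the intersections is subtracted from the sum of
          -- the two tight inequalities.
          ; size = +-cancelʳ-≤ (card (X ∩ Q)) _ _ (begin
              card (X ∪ Q) + card (X ∩ Q) ≡⟨ card-∪-∩ X Q ⟩
              card X + card Q             ≤⟨ +-mono-≤ size Q≤S ⟩
              card Y + card S             ≡⟨ sym (card-∪-∩ Y S) ⟩
              card (Y ∪ S) + card (Y ∩ S) ≤⟨ +-monoʳ-≤ (card (Y ∪ S)) overlap-size ⟩
              card (Y ∪ S) + card (X ∩ Q) ∎)
          ; root-edge = proj₁ root-edge , proj₁ (proj₂ root-edge) , proj₁ (proj₂ (proj₂ root-edge)) ,
              ∪⁺ˡ (proj₂ (proj₂ (proj₂ root-edge)))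
          }
          where
          open ≤-Reasoning
          X∪Q-false : ∀ v → (X ∪ Q) v ≡ true → col v ≡ false
          X∪Q-false v h with ∪⁻ h
          ... | inj₁ p = X-false v p
          ... | inj₂ p = Q-false p
          Y∪S-true : ∀ v → (Y ∪ S) v ≡ true → col v ≡ true
          Y∪S-true v h with ∪⁻ h
          ... | inj₁ p = Y-true v p
          ... | inj₂ p = S-true p
          closed′ : ClosedAt w (Y ∪ S) (X ∪ Q)
          closed′ e u v j u≢w h with ∪⁻ h
          ... | inj₁ p = ∪⁺ˡ (closed e u v j u≢w p)
          ... | inj₂ p = ∪⁺ʳ (closedS e u v j u≢w p)

        grown-compatible : Compatible (X ∪ Q) (Y ∪ S) col
        grown-compatible = record
          { X-false = λ v h → case-∪ (∪⁻ h) (X-false v) Q-false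
          ; Y-true  = λ v h → case-∪ (∪⁻ h) (Y-true v) S-true
          ; connOn  = λ U a Ua b Ub → Cross-mono {(X ∪ Y) ∪ (S ∪ Q)} {(X ∪ Q) ∪ (Y ∪ S)} {col} {U} to
              (ConnOn-∪ {col} {X ∪ Y} {S ∪ Q} connOn ConnOn-pair (∪⁺ʳ root) (∪⁺ˡ w∈S) U (from _ a) Ua (from _ b) Ub)
          }
          where
          case-∪ : ∀ {A B C : Set} → A ⊎ B → (A → C) → (B → C) → C
          case-∪ (inj₁ a) f g = f a
          case-∪ (inj₂ b) f g = g b
          to : ((X ∪ Y) ∪ (S ∪ Q)) ⊆ ((X ∪ Q) ∪ (Y ∪ S))
          to = ∪-⊆ (∪-⊆ (λ _ h → ∪⁺ˡ (∪⁺ˡ h)) (λ _ h → ∪⁺ʳ (∪⁺ˡ h)))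
                   (∪-⊆ (λ _ h → ∪⁺ʳ (∪⁺ʳ h)) (λ _ h → ∪⁺ˡ (∪⁺ʳ h)))
          from : ((X ∪ Q) ∪ (Y ∪ S)) ⊆ ((X ∪ Y) ∪ (S ∪ Q))
          from = ∪-⊆ (∪-⊆ (λ _ h → ∪⁺ˡ (∪⁺ˡ h)) (λ _ h → ∪⁺ʳ (∪⁺ʳ h)))
                     (∪-⊆ (λ _ h → ∪⁺ˡ (∪⁺ʳ h)) (λ _ h → ∪⁺ʳ (∪⁺ˡ h)))

        -- The type-0 neighbour `z` of `w ∈ S` is forced into `Q`, and it was outside the old core.
        grown-larger : Joins G e w z → col z ≡ false → (X ∪ Y) z ≡ false →
          card (X ∪ Y) < card ((X ∪ Q) ∪ (Y ∪ S))
        grown-larger {z = z} j z₀ z∉ = card-< {y = z}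
          (∪-⊆ (λ _ h → ∪⁺ˡ (∪⁺ˡ h)) (λ _ h → ∪⁺ʳ (∪⁺ˡ h))) (∪⁺ˡ (∪⁺ʳ (root⇒Q j z₀))) z∉

    GoodColouring : Bool → Set
    GoodColouring b = ∃[ col ] (Conn (bichromatic col) × col w ≡ b × ¬ HasTight (bichromatic col) (K col))

    -- Keeping the core fixed and `z` of type 0 during the flips means that any remaining
    -- obstruction contains `w` and absorbs `z`.
    core-step : ∀ {X Y col} → Core X Y → Compatible X Y col → GoodColouring true ⊎
      ∃[ X′ ] ∃[ Y′ ] ∃[ col′ ] (Core X′ Y′ × Compatible X′ Y′ col′ × card (X ∪ Y) < card (X′ ∪ Y′))
    core-step {X} {Y} {col} core compatible = attach (core-exit core)
      where
      open Core core
      attach : ∃[ e ] ∃[ z ] (Joins G e w z × (X ∪ Y) z ≡ false) → _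
      -- With type 0, `z` is attached to the core through `w`, so `extend` keeps its type while
      -- recolouring the rest.
      attach (e , z , j , z∉) = recolour (extend (col [ z ↦ false ]) ((X ∪ Y) ∪ (⁅ w ⁆ ∪ ⁅ z ⁆))
          (∪⁺ˡ (∪⁺ʳ root)) (ConnOn-attach {col} {X ∪ Y} (Compatible.connOn compatible) (∪⁺ʳ root) z∉ j
            (λ eq → absurd (Compatible.Y-true compatible w root) (sym eq))))
        where
        P : VSet → Set
        P col = Compatible X Y col × col z ≡ false
        grow : FlipOutcome P → _
        grow (col′ , conn , (compatible′ , _) , inj₁ ok) =
          inj₁ (col′ , conn , Compatible.Y-true compatible′ w root , ok)
        grow (col′ , conn , (compatible′ , z₀) , inj₂ (S , Q , minimal , w∈S , closedS)) =
          inj₂ (X ∪ Q , Y ∪ S , col′ , grown-core core compatible′ minimal w∈S closedS ,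
            grown-compatible core compatible′ minimal w∈S closedS ,
            grown-larger core compatible′ minimal w∈S closedS j z₀ z∉)
        recolour : ∃[ col′ ] (Agree ((X ∪ Y) ∪ (⁅ w ⁆ ∪ ⁅ z ⁆)) col′ (col [ z ↦ false ]) ×
          Conn (bichromatic col′)) → _
        recolour (col′ , agree , conn) = grow (flip-search P (Compatible-stable core z∉) col′ conn
          ( Compatible-agree (λ v h → trans (agree v (∪⁺ˡ h)) (agree-update {X ∪ Y} {z} {col} z∉ v h)) compatible
          , trans (agree z (∪⁺ʳ (∪⁺ʳ ⁅⁆-self))) update-same))

    core⇒good : ∀ X Y col → Core X Y → Compatible X Y col → GoodColouring true
    core⇒good X Y col = go (n G) X Y col (m≤n+m _ _)
      where
      go : ∀ k X Y col → n G ≤ card (X ∪ Y) + k → Core X Y → Compatible X Y col → GoodColouring true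
      go k X Y col le core compatible with core-step core compatible
      ... | inj₁ good = good
      go zero X Y col le core compatible | inj₂ (X′ , Y′ , col′ , core′ , compatible′ , lt) =
        ⊥-elim (<-irrefl refl (≤-trans (s≤s (≤-trans le (≤-reflexive (+-identityʳ _))))
          (≤-trans lt (card≤ _))))
      go (suc k) X Y col le core compatible | inj₂ (X′ , Y′ , col′ , core′ , compatible′ , lt) =
        go k X′ Y′ col′ (≤-trans le (≤-trans (≤-reflexive (+-suc _ k)) (+-monoˡ-≤ k lt))) core′ compatible′

    -- An isolated critical vertex would be closed with the empty set, against `not-closed`.
    neighbour : critical w ≡ true → ∃[ e ] ∃[ x ] Joins G e w x
    neighbour crit with any? (λ e → any? λ x → Joins? e w x)
    ... | yes p = p
    ... | no ¬p = absurd (proj₂ (card⇒member (λ _ → false) (≤-trans (s≤s z≤n)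
        (not-closed {⁅ w ⁆} {λ _ → false} (w , ⁅⁆-self) sub (λ _ _ ()) nbr)))) refl
      where
      sub : ⁅ w ⁆ ⊆ critical
      sub v h with ⁅⁆⁻ h
      ... | refl = crit
      nbr : ∀ e u v → Joins G e u v → ⁅ w ⁆ u ≡ true → false ≡ true
      nbr e u v j h with ⁅⁆⁻ h
      ... | refl = ⊥-elim (¬p (e , v , j))

    -- The initial core is a single edge at `w`.
    good-critical : critical w ≡ true → GoodColouring true
    good-critical crit with neighbour crit
    ... | e , x , j = core⇒good ⁅ x ⁆ ⁅ w ⁆ ⁅ w ⁆ core compatible
      where
      core : Core ⁅ x ⁆ ⁅ w ⁆
      core = record
        { root = ⁅⁆-self
        ; Y⊆critical = λ v h → subst (λ u → critical u ≡ true) (sym (⁅⁆⁻ h)) crit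
        ; disjoint = λ v p q → Joins-≢ j (trans (sym (⁅⁆⁻ q)) (⁅⁆⁻ p))
        ; closed = λ _ _ _ _ u≢w h → ⊥-elim (u≢w (⁅⁆⁻ h))
        ; size = ≤-reflexive (trans (card-⁅⁆ x) (sym (card-⁅⁆ w)))
        ; root-edge = e , x , j , ⁅⁆-self
        }
      x₀ : ⁅ w ⁆ x ≡ false
      x₀ = ⁅⁆-≢ (≢-sym (Joins-≢ j))
      compatible : Compatible ⁅ x ⁆ ⁅ w ⁆ ⁅ w ⁆
      compatible = record
        { X-false = λ v h → subst (λ u → ⁅ w ⁆ u ≡ false) (sym (⁅⁆⁻ h)) x₀
        ; Y-true = λ _ h → h
        ; connOn = ConnOn-edge {col = ⁅ w ⁆} (swap j) (λ eq → absurd (trans eq ⁅⁆-self) x₀)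
        }

    -- Here `w` is not in `K` for a colouring that gives it type `b`, so no tight pair can contain
    -- it and the flips succeed directly.
    good-otherwise : ∀ b → ¬ (b ≡ true × critical w ≡ true) → GoodColouring b
    good-otherwise b ¬c with extend (λ _ → b) ⁅ w ⁆ ⁅⁆-self (ConnOn-⁅⁆ {col = λ _ → b})
    ... | col , agree , conn with flip-search (λ col → col w ≡ b)
        (λ h _ y≢w _ _ → trans (update-other (≢-sym y≢w)) h) col conn (agree w ⁅⁆-self)
    ... | col′ , conn′ , w≡b , inj₁ ok = col′ , conn′ , w≡b , ok
    ... | col′ , conn′ , w≡b , inj₂ (S , Q , minimal , w∈S , _) =
      ⊥-elim (¬c (trans (sym w≡b) (proj₁ (∩⁻ w∈K)) , proj₂ (∩⁻ w∈K)))
      where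
      w∈K : K col′ w ≡ true
      w∈K = MinimalPair.S⊆K minimal w w∈S

    opaque
      goodColouring : ∀ b → GoodColouring b
      goodColouring false = good-otherwise false (λ { (() , _) })
      goodColouring true with true? (critical w)
      ... | inj₁ h = good-critical h
      ... | inj₂ h = good-otherwise true (λ p → absurd (proj₂ p) h)

-- From the colouring to the weakly even tree.

theorem1p4 : (G : Graph) → TwoEdgeConnected G → ¬ RegularBipartite G →
    (w : Vertex G) (lam : Bool) →
    ∃[ S ] ∃[ col ] (SpanningTree G S × col w ≡ lam × ProperOn G S col × WeaklyEven G S col)
theorem1p4 G (connected , _) irregular w lam with Colouring.goodColouring G connected irregular w lam
... | col , conn , w≡lam , hall
  with HallTree.hallTree G col (Colouring.K G connected irregular col) (λ _ h → proj₁ (∩⁻ h)) conn hall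
... | T , tree , proper , deg≥2 = T , col , tree , w≡lam , proper , weaklyEven
  where
  weaklyEven : WeaklyEven G T col
  weaklyEven v leaf full with true? (col v)
  ... | inj₂ h = h
  -- A type-1 vertex of full degree is in `K`, so the tree has degree at least 2 there.
  ... | inj₁ h = ⊥-elim (<-irrefl refl (≤-trans
    (deg≥2 v (∩⁺ h (Colouring.critical⁺ G connected irregular full))) (≤-reflexive leaf)))
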